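{- Let $K$ be a field which is complete with respect to a nontrivial, non-Archimedean absolute value $|\cdot|$ and which has a discrete value group $|K^\times|$, and let $\pi$ be a uniformizing parameter of $K$. Let $n$ be a positive integer, and let $A$ be an $n\times n$ matrix over $K$ with all entries in the disc $D(1,|\pi|^\ell)$ for a positive integer $\ell>2\,\mathrm{ord}_\pi(n)$. Then the following conditions hold. (a) $A$ has a simple eigenvalue $\lambda_{\max}\in K$ such that $|\lambda|<|\lambda_{\max}|$ for all other eigenvalues $\lambda\in\mathbb{C}_K$ of $A$. Moreover, $|\lambda_{\max}|=|n|$. (b) The maximal eigenvalue $\lambda_{\max}$ is an element of the disc $D(n,|\pi|^\ell/|n|)$. (c) There exists a $\lambda_{\max}$-eigenvector $\mathbf{x}$ of $A$, all of whose components are elements of the disc $D(1,|\pi|^\ell/|n|)$. (d) The limit $P_A=\lim_{k\to+\infty}\left(\frac{1}{\lambda_{\max}}A\right)^k$ exists and $P_A$ is a projection operator onto the $\lambda_{\max}$-eigenspace of $A$.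
   Context: $R=\{x\in K : |x|\leq 1\}$ is the ring of integers of $K$; a uniformizing parameter $\pi$ is an element of $R$ such that $\pi R$ is the unique maximal ideal of $R$ (equivalently $|\pi|=\max\{|x| : x\in R, |x|<1\}$). $\mathrm{ord}_\pi$ is the discrete valuation on $K$ normalized so that $|x|=|\pi|^{\mathrm{ord}_\pi(x)}$, with $\mathrm{ord}_\pi(\pi)=1$ and $\mathrm{ord}_\pi(0)=+\infty$; the integer $n$ is regarded as an element of $K$ in $|n|$ and $\mathrm{ord}_\pi(n)$ (so the hypothesis $\ell>2\,\mathrm{ord}_\pi(n)$ forces $n\neq 0$ in $K$). For $c\in K$ and real $r\geq 0$, $D(c,r)=\{x\in K : |x-c|\leq r\}$. $\mathbb{C}_K$ is the completion of the algebraic closure of $K$, with $|\cdot|$ extended (uniquely) to it. A simple eigenvalue is one of multiplicity one as a root of the characteristic polynomial. Limits of matrices are taken with respect to the norm $\|(a_{ij})\|=\max|a_{ij}|$, i.e. entrywise. -}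

module Defs where

open import Algebra.Apartness.Bundles using (HeytingField; HeytingCommutativeRing)
open import Algebra.Bundles using (CommutativeRing)
open import Algebra.Bundles.Raw using (RawRing)
import Algebra.Construct.NaturalChoice.Max as Max
import Algebra.Definitions.RawSemiring as RawSemiringDefinitions
open import Algebra.Morphism.Structures using (module RingMorphisms)
open import Axiom.ExcludedMiddle using (ExcludedMiddle)
open import Data.Bool.Base using (if_then_else_)
open import Data.Fin.Base using (Fin; zero; suc; toℕ; punchIn)
open import Data.Fin.Properties using (_≟_)
open import Data.Integer.Base as ℤ using (ℤ; +_; -[1+_])
open import Data.List.Base as List using (List; []; _∷_)
open import Data.Nat.Base as ℕ using (ℕ; zero; suc)
open import Data.Product.Base using (∃; _×_; _,_; proj₁)
open import Data.Sum.Base using (_⊎_)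
open import Data.Vec.Functional using (Vector)
open import Function.Bundles using (_⇔_)
open import Level using (Level; _⊔_) renaming (suc to lsuc)
open import Relation.Binary.Bundles using (StrictTotalOrder; DecTotalOrder)
open import Relation.Binary.Core using (Rel)
import Relation.Binary.Properties.StrictTotalOrder as StrictTotalOrderProperties
open import Relation.Binary.PropositionalEquality.Core using (_≡_)
open import Relation.Binary.Structures using (IsStrictTotalOrder)
open import Relation.Nullary using (¬_; yes; no; does)
open import Relation.Nullary.Construct.Add.Supremum using (_⁺; ⊤⁺; [_])
open import Relation.Unary using (Pred; _∈_; _∉_; _⊆_; _≐_; Satisfiable)

------------------------------------------------------------------------
-- Matrices

module Matrices {c ℓ} (R : RawRing c ℓ) where
  open RawRing R
  open RawSemiringDefinitions rawSemiring using (sum; _^_)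

  Matrix : ℕ → Set c
  Matrix n = Fin n → Fin n → Carrier

  infix  4 _≈ᵛ_ _≈ᴹ_
  infixl 7 _*ᴹ_ _*ᵛ_ _·ᴹ_ _·ᵛ_
  infixr 8 _^ᴹ_

  _≈ᵛ_ : ∀ {n} → Vector Carrier n → Vector Carrier n → Set ℓ
  v ≈ᵛ w = ∀ i → v i ≈ w i

  _≈ᴹ_ : ∀ {n} → Matrix n → Matrix n → Set ℓ
  A ≈ᴹ B = ∀ i j → A i j ≈ B i j

  1ᴹ : ∀ {n} → Matrix n
  1ᴹ i j = if does (i ≟ j) then 1# else 0#

  _*ᴹ_ : ∀ {n} → Matrix n → Matrix n → Matrix n
  (A *ᴹ B) i j = sum (λ k → A i k * B k j)

  _*ᵛ_ : ∀ {n} → Matrix n → Vector Carrier n → Vector Carrier n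
  (A *ᵛ v) i = sum (λ j → A i j * v j)

  _·ᴹ_ : ∀ {n} → Carrier → Matrix n → Matrix n
  (x ·ᴹ A) i j = x * A i j

  _·ᵛ_ : ∀ {n} → Carrier → Vector Carrier n → Vector Carrier n
  (x ·ᵛ v) i = x * v i

  _^ᴹ_ : ∀ {n} → Matrix n → ℕ → Matrix n
  A ^ᴹ zero  = 1ᴹ
  A ^ᴹ suc k = A *ᴹ (A ^ᴹ k)

  -- Laplace expansion along the first row.
  det : ∀ {n} → Matrix n → Carrier
  det {zero}  A = 1#
  det {suc n} A = sum λ j →
    (- 1#) ^ toℕ j * (A zero j * det (λ i k → A (suc i) (punchIn j k)))

  IsEigenvector : ∀ {n} → Matrix n → Carrier → Vector Carrier n → Set ℓ
  IsEigenvector A x v = ¬ (∀ i → v i ≈ 0#) × (A *ᵛ v) ≈ᵛ (x ·ᵛ v)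

  IsEigenvalue : ∀ {n} → Matrix n → Carrier → Set (c ⊔ ℓ)
  IsEigenvalue A x = ∃ λ v → IsEigenvector A x v

  -- P is idempotent with range {v | A v = x v}.
  IsProjectionOntoEigenspace : ∀ {n} → Matrix n → Matrix n → Carrier → Set (c ⊔ ℓ)
  IsProjectionOntoEigenspace P A x =
    (P *ᴹ P) ≈ᴹ P ×
    (∀ v → (∃ λ u → (P *ᵛ u) ≈ᵛ v) ⇔ ((A *ᵛ v) ≈ᵛ (x ·ᵛ v)))

------------------------------------------------------------------------
-- Polynomials

-- A polynomial is the list of its coefficients, constant term first;
-- trailing zeros are allowed and ignored by the equality.

module Polynomials {c ℓ} (R : RawRing c ℓ) where
  open RawRing R

  Poly : Set c
  Poly = List Carrier

  coeff : Poly → ℕ → Carrier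
  coeff []      _       = 0#
  coeff (x ∷ p) zero    = x
  coeff (x ∷ p) (suc i) = coeff p i

  eval : Poly → Carrier → Carrier
  eval []      x = 0#
  eval (y ∷ p) x = y + x * eval p x

  infix  4 _≈ᴾ_
  infixl 6 _+ᴾ_
  infixl 7 _*ᴾ_
  infix  8 -ᴾ_

  _≈ᴾ_ : Rel Poly ℓ
  p ≈ᴾ q = ∀ i → coeff p i ≈ coeff q i

  _+ᴾ_ : Poly → Poly → Poly
  []      +ᴾ q       = q
  (x ∷ p) +ᴾ []      = x ∷ p
  (x ∷ p) +ᴾ (y ∷ q) = x + y ∷ p +ᴾ q

  -ᴾ_ : Poly → Poly
  -ᴾ p = List.map -_ p

  _*ᴾ_ : Poly → Poly → Poly
  []      *ᴾ q = []
  (x ∷ p) *ᴾ q = List.map (x *_) q +ᴾ (0# ∷ p *ᴾ q)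

  polyRing : RawRing c ℓ
  polyRing = record
    { Carrier = Poly
    ; _≈_     = _≈ᴾ_
    ; _+_     = _+ᴾ_
    ; _*_     = _*ᴾ_
    ; -_      = -ᴾ_
    ; 0#      = []
    ; 1#      = 1# ∷ []
    }

  const : Carrier → Poly
  const x = x ∷ []

  X : Poly
  X = 0# ∷ 1# ∷ []

  open RawSemiringDefinitions (RawRing.rawSemiring polyRing)
    using (_∣_; _∤_; _^_)

  HasRootOfMultiplicity : Poly → Carrier → ℕ → Set (c ⊔ ℓ)
  HasRootOfMultiplicity p x m =
    (X +ᴾ -ᴾ const x) ^ m ∣ p × (X +ᴾ -ᴾ const x) ^ suc m ∤ p

  open Matrices using (Matrix)

  charPoly : ∀ {n} → Matrix R n → Poly
  charPoly A = det (λ i j → (X *ᴾ 1ᴹ i j) +ᴾ -ᴾ const (A i j))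
    where open Matrices polyRing using (det; 1ᴹ)

  IsSimpleEigenvalue : ∀ {n} → Matrix R n → Carrier → Set (c ⊔ ℓ)
  IsSimpleEigenvalue A x =
    Matrices.IsEigenvalue R A x × HasRootOfMultiplicity (charPoly A) x 1

------------------------------------------------------------------------
-- Fields

-- In the presence of excluded middle, tightness makes _#_ the same as
-- _≉_, so that a Heyting field is a field in the classical sense.

Field : (a : Level) → Set (lsuc a)
Field a = HeytingField a a a

module FieldOperations {a} (F : Field a) where
  open HeytingField F public
  open HeytingCommutativeRing heytingCommutativeRing public
    using (commutativeRing)
  open CommutativeRing commutativeRing public
    using (rawRing; _≉_)
  open RawSemiringDefinitions (RawRing.rawSemiring rawRing) public
    using (_^_)
    renaming (_×_ to _·_)

  fromℕ : ℕ → Carrier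
  fromℕ n = n · 1#

module Inverse {a} (em : ExcludedMiddle a) (F : Field a) where
  open FieldOperations F

  infix  8 _⁻¹
  infixl 7 _/_
  infixr 8 _^ℤ_

  -- Made total by the convention 0⁻¹ = 0.  (For x # 0 the library supplies
  -- an inverse of x - 0#.)
  _⁻¹ : Carrier → Carrier
  x ⁻¹ with em {P = x # 0#}
  ... | yes x#0 = proj₁ (#⇒invertible x#0)
  ... | no  _   = 0#

  _/_ : Carrier → Carrier → Carrier
  x / y = x * y ⁻¹

  _^ℤ_ : Carrier → ℤ → Carrier
  x ^ℤ (+ m)    = x ^ m
  x ^ℤ -[1+ m ] = (x ^ suc m) ⁻¹

module _ {a} (F G : Field a) where
  private
    module F = FieldOperations F
    module G = FieldOperations G

  IsFieldHomomorphism : (F.Carrier → G.Carrier) → Set a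
  IsFieldHomomorphism = IsRingHomomorphism
    where open RingMorphisms F.rawRing G.rawRing

  private
    module FP = Polynomials F.rawRing
    module GP = Polynomials G.rawRing

  record IsAlgebraicClosure (ι : F.Carrier → G.Carrier) : Set a where
    field
      isFieldHomomorphism : IsFieldHomomorphism ι
      algebraic           : ∀ x → ∃ λ p →
                            (∃ λ i → FP.coeff p i F.≉ F.0#) ×
                            GP.eval (List.map ι p) x G.≈ G.0#
      algebraicallyClosed : ∀ p → (∃ λ i → GP.coeff p (suc i) G.≉ G.0#) →
                            ∃ λ x → GP.eval p x G.≈ G.0#

------------------------------------------------------------------------
-- Real numbers

-- The real numbers are given axiomatically, as a Dedekind-complete
-- ordered field; classically this determines them up to isomorphism.

record Reals a : Set (lsuc a) where
  field
    realField : Field a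
  open FieldOperations realField public
  infix 4 _<_
  field
    _<_                : Rel Carrier a
    isStrictTotalOrder : IsStrictTotalOrder _≈_ _<_
    +-monoʳ-<          : ∀ x {y z} → y < z → x + y < x + z
    *-positive         : ∀ {x y} → 0# < x → 0# < y → 0# < x * y

  strictTotalOrder : StrictTotalOrder a a a
  strictTotalOrder = record { isStrictTotalOrder = isStrictTotalOrder }

  open StrictTotalOrderProperties strictTotalOrder public
    using (decTotalOrder)
  open DecTotalOrder decTotalOrder public using (_≤_; totalOrder)
  open Max totalOrder public using () renaming (_⊔_ to max)

  IsUpperBound : Pred Carrier a → Carrier → Set a
  IsUpperBound S b = ∀ {x} → x ∈ S → x ≤ b

  field
    supremum : (S : Pred Carrier a) → Satisfiable S → ∃ (IsUpperBound S) →
               ∃ λ s → IsUpperBound S s × (∀ {b} → IsUpperBound S b → s ≤ b)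

------------------------------------------------------------------------
-- Fields with a non-Archimedean absolute value

record NonArchimedeanField {a} (ℝ : Reals a) : Set (lsuc a) where
  private module ℝ = Reals ℝ
  field
    baseField : Field a
  open FieldOperations baseField public
  field
    ∣_∣         : Carrier → ℝ.Carrier
    ∣∣-cong     : ∀ {x y} → x ≈ y → ∣ x ∣ ℝ.≈ ∣ y ∣
    ∣∣-nonneg   : ∀ x → ℝ.0# ℝ.≤ ∣ x ∣
    ∣0∣         : ∣ 0# ∣ ℝ.≈ ℝ.0#
    ∣∣-definite : ∀ {x} → ∣ x ∣ ℝ.≈ ℝ.0# → x ≈ 0#
    ∣∣-*        : ∀ x y → ∣ x * y ∣ ℝ.≈ ∣ x ∣ ℝ.* ∣ y ∣
    ∣∣-+        : ∀ x y → ∣ x + y ∣ ℝ.≤ ℝ.max ∣ x ∣ ∣ y ∣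

  open Matrices rawRing public
  open Polynomials rawRing public using (IsSimpleEigenvalue)

  IsNontrivial : Set a
  IsNontrivial = ∃ λ x → x ≉ 0# × ¬ (∣ x ∣ ℝ.≈ ℝ.1#)

  -- Each value ∣ x ∣ is isolated in the value group {∣ y ∣ | y ≠ 0}.
  HasDiscreteValueGroup : Set a
  HasDiscreteValueGroup = ∀ x → x ≉ 0# → ∃ λ ε → ℝ.0# ℝ.< ε ×
    (∀ y → y ≉ 0# → ∣ y ∣ ℝ.< ∣ x ∣ ℝ.+ ε → ∣ x ∣ ℝ.< ∣ y ∣ ℝ.+ ε →
     ∣ y ∣ ℝ.≈ ∣ x ∣)

  infix 4 _⟶_ _⟶ᴹ_

  _⟶_ : (ℕ → Carrier) → Carrier → Set a
  s ⟶ x = ∀ {ε} → ℝ.0# ℝ.< ε →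
          ∃ λ N → ∀ k → N ℕ.≤ k → ∣ s k - x ∣ ℝ.< ε

  IsCauchy : (ℕ → Carrier) → Set a
  IsCauchy s = ∀ {ε} → ℝ.0# ℝ.< ε →
               ∃ λ N → ∀ j k → N ℕ.≤ j → N ℕ.≤ k → ∣ s j - s k ∣ ℝ.< ε

  IsComplete : Set a
  IsComplete = ∀ s → IsCauchy s → ∃ λ x → s ⟶ x

  _⟶ᴹ_ : ∀ {n} → (ℕ → Matrix n) → Matrix n → Set a
  S ⟶ᴹ P = ∀ i j → (λ k → S k i j) ⟶ P i j

  D : Carrier → ℝ.Carrier → Pred Carrier a
  D c r x = ∣ x - c ∣ ℝ.≤ r

  Integers : Pred Carrier a
  Integers x = ∣ x ∣ ℝ.≤ ℝ.1#

  record IsIdeal (I : Pred Carrier a) : Set a where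
    field
      ⊆-Integers : I ⊆ Integers
      resp-≈     : ∀ {x y} → x ≈ y → x ∈ I → y ∈ I
      0∈         : 0# ∈ I
      +-closed   : ∀ {x y} → x ∈ I → y ∈ I → x + y ∈ I
      *-closed   : ∀ {r x} → r ∈ Integers → x ∈ I → r * x ∈ I

  record IsMaximalIdeal (I : Pred Carrier a) : Set (lsuc a) where
    field
      isIdeal : IsIdeal I
      proper  : 1# ∉ I
      maximal : ∀ (J : Pred Carrier a) → IsIdeal J → I ⊆ J →
                J ≐ I ⊎ J ≐ Integers

  principal : Carrier → Pred Carrier a
  principal x y = ∃ λ r → r ∈ Integers × y ≈ x * r

  record IsUniformizer (π : Carrier) : Set (lsuc a) where
    field
      integral  : π ∈ Integers
      isMaximal : IsMaximalIdeal (principal π)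
      unique    : ∀ I → IsMaximalIdeal I → I ≐ principal π

record IsIsometricEmbedding {a} {ℝ : Reals a} (K L : NonArchimedeanField ℝ)
  (ι : NonArchimedeanField.Carrier K → NonArchimedeanField.Carrier L) : Set a
  where
  private
    module ℝ = Reals ℝ
    module K = NonArchimedeanField K
    module L = NonArchimedeanField L
  field
    isFieldHomomorphism : IsFieldHomomorphism K.baseField L.baseField ι
    isometric           : ∀ x → L.∣ ι x ∣ ℝ.≈ K.∣ x ∣

-- The completion ℂ of an algebraic closure K̄ of K, the absolute value
-- of K being extended first to K̄ and then to ℂ.

record CompletedAlgebraicClosure {a} {ℝ : Reals a} (K : NonArchimedeanField ℝ) :
  Set (lsuc a) where
  private
    module ℝ = Reals ℝ
    module K = NonArchimedeanField K
  field
    K̄ ℂ : NonArchimedeanField ℝ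
  private module K̄ = NonArchimedeanField K̄
  module ℂ = NonArchimedeanField ℂ
  field
    K→K̄                : K.Carrier → K̄.Carrier
    K̄→ℂ                : K̄.Carrier → ℂ.Carrier
    isAlgebraicClosure : IsAlgebraicClosure K.baseField K̄.baseField K→K̄
    K→K̄-isometric      : IsIsometricEmbedding K K̄ K→K̄
    K̄→ℂ-isometric      : IsIsometricEmbedding K̄ ℂ K̄→ℂ
    dense              : ∀ z {ε} → ℝ.0# ℝ.< ε →
                         ∃ λ x → ℂ.∣ K̄→ℂ x ℂ.- z ∣ ℝ.< ε
    complete           : ℂ.IsComplete

  ι : K.Carrier → ℂ.Carrier
  ι x = K̄→ℂ (K→K̄ x)

------------------------------------------------------------------------
-- The normalized discrete valuation

-- Extends multiplication by 2 on ℤ by 2 · ∞ = ∞.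
twice : ℤ ⁺ → ℤ ⁺
twice [ m ] = [ + 2 ℤ.* m ]
twice ⊤⁺    = ⊤⁺

module _ {a} (em : ExcludedMiddle a) {ℝ : Reals a} (K : NonArchimedeanField ℝ) where
  private
    module ℝ = Reals ℝ
    module K = NonArchimedeanField K
  open Inverse em ℝ.realField using (_^ℤ_)

  _^⁺_ : ℝ.Carrier → ℤ ⁺ → ℝ.Carrier
  r ^⁺ [ m ] = r ^ℤ m
  r ^⁺ ⊤⁺    = ℝ.0#

  record IsNormalizedValuation (π : K.Carrier) (ord : K.Carrier → ℤ ⁺) :
    Set a where
    field
      ∣x∣≈∣π∣^ord : ∀ x → K.∣ x ∣ ℝ.≈ (K.∣ π ∣ ^⁺ ord x)
      ord-π       : ord π ≡ [ + 1 ]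
      ord-0       : ord K.0# ≡ ⊤⁺

{-# OPTIONS --safe #-}

-- The power iteration x ↦ A x / (A x)₀ contracts the ball of radius |π|^ℓ / |n|
-- around (1, …, 1) by the factor |π|^ℓ / |n|² < 1; its fixed point is an
-- eigenvector x of A, and the same argument for the transpose gives a left
-- eigenvector w.  On the invariant hyperplane w · v = 0 the matrix A agrees with
-- A - 1 wᵀ, whose entries are at most |π|^ℓ / |n| < |n|, so every other eigenvalue
-- is smaller than |n| and (λ⁻¹ A)ᵏ tends to the projection x wᵀ / (w · x).
-- Conjugating by the unipotent matrix with first column x gives
-- χ (t) = (t - λ) det (t - C), where C also has entries at most |π|^ℓ / |n|;
-- hence |det (t - C)| = |t|ⁿ⁻¹ for |t| = |n|, and λ is a simple root.

module Submission where

open import Defs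
open import Algebra.Bundles using (CommutativeRing)
open import Algebra.Bundles.Raw using (RawRing)
import Algebra.Construct.NaturalChoice.Max as Max
import Algebra.Definitions.RawMagma as RawMagmaDefinitions
import Algebra.Definitions.RawSemiring as RawSemiringDefinitions
import Algebra.Morphism.Construct.Composition as Composition
open import Algebra.Morphism.Structures using (module RingMorphisms)
import Algebra.Properties.AbelianGroup as AbelianGroupProperties
import Algebra.Properties.Monoid.Mult.TCOptimised as Mult′
import Algebra.Properties.Ring as RingProperties
import Algebra.Properties.Semiring.Exp as Exp
import Algebra.Properties.Semiring.Mult as Mult
import Algebra.Properties.Semiring.Sum as Sum
import Algebra.Solver.Ring
open import Algebra.Solver.Ring.AlmostCommutativeRing
  using (fromCommutativeRing; _-Raw-AlmostCommutative⟶_)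
open import Axiom.ExcludedMiddle using (ExcludedMiddle)
open import Data.Bool.Base using (true; false; if_then_else_)
open import Data.Fin.Base using (Fin; zero; suc; toℕ; punchIn)
open import Data.Fin.Properties using (_≟_)
open import Data.Integer.Base as ℤ using (ℤ; +_; -[1+_])
import Data.Integer.Properties as ℤ
import Data.List.Base as List
open import Data.Maybe.Base as Maybe using (Maybe)
open import Data.Nat.Base as ℕ using (ℕ; zero; suc; NonZero)
import Data.Nat.Properties as ℕ
open import Data.Product.Base using (∃; _×_; _,_; proj₁; proj₂)
open import Data.Sign.Base as Sign using (Sign)
open import Data.Sum.Base using (inj₁; inj₂)
open import Data.Vec.Functional as Vector using (Vector; transpose; replicate)
open import Function.Base using (_∘_)
open import Function.Bundles using (mk⇔)
open import Relation.Binary.Bundles using (StrictTotalOrder; DecTotalOrder)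
open import Relation.Binary.Construct.Add.Supremum.Strict ℤ._<_ using (_<⁺_; [_])
open import Relation.Binary.Definitions using (tri<; tri≈; tri>)
open import Relation.Binary.PropositionalEquality.Core as ≡ using ()
import Relation.Binary.Reasoning.Setoid as ≈-Reasoning
import Relation.Binary.Reasoning.StrictPartialOrder as <-Reasoning
open import Relation.Nullary using (¬_; yes; no; does)
open import Relation.Nullary.Construct.Add.Supremum using (_⁺; ⊤⁺; [_])
open import Relation.Nullary.Decidable using (dec⇒maybe)
open import Relation.Nullary.Negation using (contradiction)
open import Relation.Unary using (Pred; _∈_)

-- The library's ring solver only cancels x against - x when equality of
-- coefficients is decidable, so it is instantiated with coefficients in ℤ.

-- The hypothesis `ℓ > 2 ord n` pays for two divisions. The rows of `A` differ by at most `|π|^ℓ`;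
-- normalizing divides this by a pivot of absolute value `|n|`, whence the radius. A difference of
-- two normalized vectors has two pivots in its denominator, whence the contraction factor, which is
-- below 1 exactly under the hypothesis. The left eigenvector takes the place of spectral theory
-- over `ℂ_K`. Pairing with it uses ring operations only, so a single estimate on its hyperplane
-- bounds the other eigenvalues in `ℂ_K`, shows that the eigenspace over `K` is a line, and controls
-- the powers of `A`. None of this sees the algebraic multiplicity, which is a divisibility
-- statement about the characteristic polynomial. To split off a linear factor, the determinant,
-- given by Laplace expansion, has to be shown alternating and invariant under row operations.
-- Multiplicity is then tested by values at points `μ + πᵏ`, so that no uniqueness of polynomial
-- division enters.

module IntegerSolver {c ℓ} (R : CommutativeRing c ℓ) where
  open CommutativeRing R hiding (zero)
  open RingProperties ring
  open AbelianGroupProperties +-abelianGroup using (⁻¹-∙-comm)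
  open Mult semiring using (×-homo-+; ×1-homo-*) renaming (_×_ to _·_)
  open Mult′ +-monoid using (×ᵤ≈×) renaming (_×_ to _·′_)
  open ≈-Reasoning setoid

  -- With `_·′_` the multiple `1 ·′ 1#` reduces to `1#` and not to `1# + 0#`, so `con (+ 1)` in a
  -- solver equation stands for `1#` on the nose.
  fromℤ : ℤ → Carrier
  fromℤ (+ n)    = n ·′ 1#
  fromℤ -[1+ n ] = - (suc n ·′ 1#)

  private
    ·≈·′ : ∀ n → n · 1# ≈ n ·′ 1#
    ·≈·′ n = ×ᵤ≈× n 1#

    +-homo-ℕ : ∀ m n → (m ℕ.+ n) ·′ 1# ≈ m ·′ 1# + n ·′ 1#
    +-homo-ℕ m n = begin
      (m ℕ.+ n) ·′ 1#       ≈⟨ ·≈·′ (m ℕ.+ n) ⟨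
      (m ℕ.+ n) · 1#        ≈⟨ ×-homo-+ 1# m n ⟩
      m · 1# + n · 1#       ≈⟨ +-cong (·≈·′ m) (·≈·′ n) ⟩
      m ·′ 1# + n ·′ 1#     ∎

    *-homo-ℕ : ∀ m n → (m ℕ.* n) ·′ 1# ≈ (m ·′ 1#) * (n ·′ 1#)
    *-homo-ℕ m n = begin
      (m ℕ.* n) ·′ 1#         ≈⟨ ·≈·′ (m ℕ.* n) ⟨
      (m ℕ.* n) · 1#          ≈⟨ ×1-homo-* m n ⟩
      (m · 1#) * (n · 1#)     ≈⟨ *-cong (·≈·′ m) (·≈·′ n) ⟩
      (m ·′ 1#) * (n ·′ 1#)   ∎

    cancel : ∀ x y z → (x + y) - (x + z) ≈ y - z
    cancel x y z = begin
      (x + y) - (x + z)      ≈⟨ +-cong (+-comm x y) (sym (⁻¹-∙-comm x z)) ⟩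
      (y + x) + (- x - z)    ≈⟨ +-assoc y x _ ⟩
      y + (x + (- x - z))    ≈⟨ +-congˡ (+-assoc x (- x) _) ⟨
      y + ((x - x) - z)      ≈⟨ +-congˡ (trans (+-congʳ (-‿inverseʳ x)) (+-identityˡ _)) ⟩
      y - z                  ∎

    ⊖-homo : ∀ m n → fromℤ (m ℤ.⊖ n) ≈ m ·′ 1# - n ·′ 1#
    ⊖-homo zero    zero    = sym (trans (+-congˡ -0#≈0#) (+-identityʳ _))
    ⊖-homo zero    (suc n) = sym (+-identityˡ _)
    ⊖-homo (suc m) zero    = sym (trans (+-congˡ -0#≈0#) (+-identityʳ _))
    ⊖-homo (suc m) (suc n) = begin
      fromℤ (suc m ℤ.⊖ suc n)                 ≡⟨ ≡.cong fromℤ (ℤ.[1+m]⊖[1+n]≡m⊖n m n) ⟩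
      fromℤ (m ℤ.⊖ n)                         ≈⟨ ⊖-homo m n ⟩
      m ·′ 1# - n ·′ 1#                       ≈⟨ cancel 1# _ _ ⟨
      (1# + m ·′ 1#) - (1# + n ·′ 1#)         ≈⟨ +-cong (+-homo-ℕ 1 m) (-‿cong (+-homo-ℕ 1 n)) ⟨
      suc m ·′ 1# - suc n ·′ 1#               ∎

    signed : Sign → Carrier → Carrier
    signed Sign.+ x = x
    signed Sign.- x = - x

    signed-cong : ∀ s {x y} → x ≈ y → signed s x ≈ signed s y
    signed-cong Sign.+ = λ x≈y → x≈y
    signed-cong Sign.- = -‿cong

    fromℤ-◃ : ∀ s n → fromℤ (s ℤ.◃ n) ≈ signed s (n ·′ 1#)
    fromℤ-◃ Sign.+ zero    = refl
    fromℤ-◃ Sign.- zero    = sym -0#≈0#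
    fromℤ-◃ Sign.+ (suc n) = refl
    fromℤ-◃ Sign.- (suc n) = refl

    signed-abs : ∀ i → fromℤ i ≈ signed (ℤ.sign i) (ℤ.∣ i ∣ ·′ 1#)
    signed-abs (+ n)    = refl
    signed-abs -[1+ n ] = refl

    signed-* : ∀ s t x y → signed (s Sign.* t) (x * y) ≈ signed s x * signed t y
    signed-* Sign.+ Sign.+ x y = refl
    signed-* Sign.+ Sign.- x y = -‿distribʳ-* x y
    signed-* Sign.- Sign.+ x y = -‿distribˡ-* x y
    signed-* Sign.- Sign.- x y = begin
      x * y         ≈⟨ -‿involutive _ ⟨
      - - (x * y)   ≈⟨ -‿cong (-‿distribʳ-* x y) ⟩
      - (x * - y)   ≈⟨ -‿distribˡ-* x (- y) ⟩
      - x * - y     ∎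

  +-homo : ∀ i j → fromℤ (i ℤ.+ j) ≈ fromℤ i + fromℤ j
  +-homo (+ m)    (+ n)    = +-homo-ℕ m n
  +-homo (+ m)    -[1+ n ] = ⊖-homo m (suc n)
  +-homo -[1+ m ] (+ n)    = trans (⊖-homo n (suc m)) (+-comm _ _)
  +-homo -[1+ m ] -[1+ n ] = begin
    - (suc (suc (m ℕ.+ n)) ·′ 1#)        ≡⟨ ≡.cong (λ k → - (k ·′ 1#)) (≡.cong suc (≡.sym (ℕ.+-suc m n))) ⟩
    - ((suc m ℕ.+ suc n) ·′ 1#)          ≈⟨ -‿cong (+-homo-ℕ (suc m) (suc n)) ⟩
    - (suc m ·′ 1# + suc n ·′ 1#)        ≈⟨ ⁻¹-∙-comm _ _ ⟨
    - (suc m ·′ 1#) - suc n ·′ 1#        ∎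

  -- A product of integers is by definition a sign attached to a product of absolute values, so the
  -- two ingredients are transported separately.
  *-homo : ∀ i j → fromℤ (i ℤ.* j) ≈ fromℤ i * fromℤ j
  *-homo i j = begin
    fromℤ (s Sign.* t ℤ.◃ ℤ.∣ i ∣ ℕ.* ℤ.∣ j ∣)            ≈⟨ fromℤ-◃ (s Sign.* t) (ℤ.∣ i ∣ ℕ.* ℤ.∣ j ∣) ⟩
    signed (s Sign.* t) ((ℤ.∣ i ∣ ℕ.* ℤ.∣ j ∣) ·′ 1#)     ≈⟨ signed-cong (s Sign.* t) (*-homo-ℕ ℤ.∣ i ∣ ℤ.∣ j ∣) ⟩
    signed (s Sign.* t) (ℤ.∣ i ∣ ·′ 1# * (ℤ.∣ j ∣ ·′ 1#)) ≈⟨ signed-* s t (ℤ.∣ i ∣ ·′ 1#) (ℤ.∣ j ∣ ·′ 1#) ⟩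
    signed s (ℤ.∣ i ∣ ·′ 1#) * signed t (ℤ.∣ j ∣ ·′ 1#)   ≈⟨ *-cong (signed-abs i) (signed-abs j) ⟨
    fromℤ i * fromℤ j                                     ∎
    where
    s = ℤ.sign i
    t = ℤ.sign j

  -‿homo : ∀ i → fromℤ (ℤ.- i) ≈ - fromℤ i
  -‿homo (+ zero)  = sym -0#≈0#
  -‿homo (+ suc n) = refl
  -‿homo -[1+ n ]  = sym (-‿involutive _)

  private
    morphism : ℤ.+-*-rawRing -Raw-AlmostCommutative⟶ fromCommutativeRing R
    morphism = record
      { ⟦_⟧    = fromℤ
      ; +-homo = +-homo
      ; *-homo = *-homo
      ; -‿homo = -‿homo
      ; 0-homo = refl
      ; 1-homo = refl
      }

    _coeff≟_ : ∀ i j → Maybe (fromℤ i ≈ fromℤ j)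
    i coeff≟ j = Maybe.map (λ i≡j → reflexive (≡.cong fromℤ i≡j)) (dec⇒maybe (i ℤ.≟ j))

  open Algebra.Solver.Ring ℤ.+-*-rawRing (fromCommutativeRing R) morphism _coeff≟_ public
    using (solve; _:=_; con; _:+_; _:*_; _:-_; :-_)

-- Determinants: expansions, row operations and deflation

module Determinant {c ℓ} (R : CommutativeRing c ℓ) where
  open Vector using (_∷_)
  open CommutativeRing R hiding (zero)
  open Matrices rawRing
  open Sum semiring
  open RingProperties ring using (-0#≈0#)
  open RawSemiringDefinitions (RawRing.rawSemiring rawRing) using (_^_)
  open IntegerSolver R
  open ≈-Reasoning setoid

  private
    sign : ∀ {n} → Fin n → Carrier
    sign j = (- 1#) ^ toℕ j

  sum-zero : ∀ {n} {f : Vector Carrier n} → (∀ i → f i ≈ 0#) → sum f ≈ 0#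
  sum-zero {n} f≈0 = trans (sum-cong-≋ f≈0) (sum-replicate-zero n)

  -- An opaque copy of det: the determinant of a matrix with a nonempty row
  -- would otherwise unfold during unification.
  opaque
    Δ : ∀ {n} → Matrix n → Carrier
    Δ = det

    Δ≈det : ∀ {n} (A : Matrix n) → Δ A ≈ det A
    Δ≈det A = refl

    Δ-empty : (A : Matrix zero) → Δ A ≈ 1#
    Δ-empty A = refl

    Δ-expandRow : ∀ {n} (A : Matrix (suc n)) → Δ A ≈
      sum λ j → sign j * (A zero j * Δ (λ i k → A (suc i) (punchIn j k)))
    Δ-expandRow A = refl

    Δ-cong : ∀ {n} {A B : Matrix n} → A ≈ᴹ B → Δ A ≈ Δ B
    Δ-cong {zero}  A≈B = refl
    Δ-cong {suc n} A≈B = sum-cong-≋ λ j →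
      *-congˡ {sign j} (*-cong (A≈B zero j) (Δ-cong λ i k → A≈B (suc i) (punchIn j k)))

  -- The corner term is common to both expansions. In the others the minors of the row expansion are
  -- expanded along their first column by induction; exchanging the two sums and reading the inner
  -- one as a row expansion gives the claim, since `sign (suc j) * sign i` and
  -- `sign j * sign (suc i)` agree.
  Δ-expandColumn : ∀ {n} (A : Matrix (suc n)) → Δ A ≈
    sum λ i → sign i * (A i zero * Δ (λ k l → A (punchIn i k) (suc l)))
  Δ-expandColumn {zero}  A = Δ-expandRow A
  Δ-expandColumn {suc n} A = trans (Δ-expandRow A) (+-congˡ (begin
    sum (λ j → sign (suc j) * (A zero (suc j) *
      Δ (λ i k → A (suc i) (punchIn (suc j) k))))
      ≈⟨ (sum-cong-≋ λ j → *-congˡ {sign (suc j)} (*-congˡ {A zero (suc j)}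
           (Δ-expandColumn λ i k → A (suc i) (punchIn (suc j) k)))) ⟩
    sum (λ j → sign (suc j) * (A zero (suc j) *
      sum λ i → sign i * (A (suc i) zero * D i j)))
      ≈⟨ sum-cong-≋ (λ j → push (sign (suc j)) (A zero (suc j))
           (λ i → sign i * (A (suc i) zero * D i j))) ⟩
    sum (λ j → sum λ i → sign (suc j) * (A zero (suc j) *
      (sign i * (A (suc i) zero * D i j))))
      ≈⟨ ∑-comm (λ j i → sign (suc j) * (A zero (suc j) *
           (sign i * (A (suc i) zero * D i j)))) ⟩
    sum (λ i → sum λ j → sign (suc j) * (A zero (suc j) *
      (sign i * (A (suc i) zero * D i j))))
      ≈⟨ (sum-cong-≋ λ i → sum-cong-≋ λ j →
           swap (sign j) (A zero (suc j)) (sign i) (A (suc i) zero) (D i j)) ⟩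
    sum (λ i → sum λ j → sign (suc i) * (A (suc i) zero *
      (sign j * (A zero (suc j) * D i j))))
      ≈⟨ sum-cong-≋ (λ i → push (sign (suc i)) (A (suc i) zero)
           (λ j → sign j * (A zero (suc j) * D i j))) ⟨
    sum (λ i → sign (suc i) * (A (suc i) zero *
      sum λ j → sign j * (A zero (suc j) * D i j)))
      ≈⟨ (sum-cong-≋ λ i → *-congˡ {sign (suc i)} (*-congˡ {A (suc i) zero}
           (Δ-expandRow λ k l → A (punchIn (suc i) k) (suc l)))) ⟨
    sum (λ i → sign (suc i) * (A (suc i) zero *
      Δ (λ k l → A (punchIn (suc i) k) (suc l))))
      ∎))
    where
    D : Fin (suc n) → Fin (suc n) → Carrier
    D i j = Δ (λ k l → A (suc (punchIn i k)) (suc (punchIn j l)))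
    push : ∀ x y {n} (f : Vector Carrier n) → x * (y * sum f) ≈ sum (λ i → x * (y * f i))
    push x y f = trans (*-congˡ (*-distribˡ-sum y f)) (*-distribˡ-sum x (λ i → y * f i))
    swap : ∀ s a t b d → (- 1# * s) * (a * (t * (b * d))) ≈ (- 1# * t) * (b * (s * (a * d)))
    swap = solve 5 (λ s a t b d → (:- con (+ 1) :* s) :* (a :* (t :* (b :* d))) :=
                                  (:- con (+ 1) :* t) :* (b :* (s :* (a :* d)))) refl

  Δ-transpose : ∀ {n} (A : Matrix n) → Δ (transpose A) ≈ Δ A
  Δ-transpose {zero}  A = trans (Δ-empty _) (sym (Δ-empty A))
  Δ-transpose {suc n} A = begin
    Δ (transpose A)
      ≈⟨ Δ-expandRow (transpose A) ⟩
    sum (λ j → sign j * (A j zero * Δ (transpose λ i k → A (punchIn j i) (suc k))))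
      ≈⟨ (sum-cong-≋ λ j → *-congˡ {sign j} (*-congˡ {A j zero}
           (Δ-transpose (λ i k → A (punchIn j i) (suc k))))) ⟩
    sum (λ j → sign j * (A j zero * Δ (λ i k → A (punchIn j i) (suc k))))
      ≈⟨ Δ-expandColumn A ⟨
    Δ A ∎

  private
    variable
      n : ℕ

    linear-term : ∀ s a c b d → s * ((a + c * b) * d) ≈ s * (a * d) + c * (s * (b * d))
    linear-term = solve 5 (λ s a c b d → s :* ((a :+ c :* b) :* d) :=
                                         s :* (a :* d) :+ c :* (s :* (b :* d))) refl

    sum-linear : (f g : Vector Carrier n) (c : Carrier) →
                 sum (λ i → f i + c * g i) ≈ sum f + c * sum g
    sum-linear f g c = trans (∑-distrib-+ f (λ i → c * g i)) (+-congˡ (sym (*-distribˡ-sum c g)))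

    -- Row and minors are independent arguments here. The expression is linear in each, and this
    -- yields linearity of the determinant in its first row and, through the minors, in its second.
    expansion : Vector Carrier (suc n) → Vector Carrier (suc n) → Carrier
    expansion a D = sum λ j → sign j * (a j * D j)

    expansion-congʳ : ∀ (a : Vector Carrier (suc n)) {D E} → (∀ j → D j ≈ E j) →
                      expansion a D ≈ expansion a E
    expansion-congʳ a {D} {E} D≈E =
      sum-cong-≋ {x = λ j → sign j * (a j * D j)} {y = λ j → sign j * (a j * E j)}
        λ j → *-congˡ (*-congˡ (D≈E j))

    expansion-linearˡ : (a b : Vector Carrier (suc n)) (c : Carrier) (D : Vector Carrier (suc n)) →
      expansion (λ j → a j + c * b j) D ≈ expansion a D + c * expansion b D
    expansion-linearˡ a b c D = trans
      (sum-cong-≋ {x = λ j → sign j * ((a j + c * b j) * D j)} {y = λ j → f a j + c * f b j}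
        λ j → linear-term (sign j) (a j) c (b j) (D j))
      (sum-linear (f a) (f b) c)
      where
      f : Vector Carrier _ → Vector Carrier _
      f a j = sign j * (a j * D j)

    expansion-linearʳ : (r D E : Vector Carrier (suc n)) (c : Carrier) →
      expansion r (λ j → D j + c * E j) ≈ expansion r D + c * expansion r E
    expansion-linearʳ r D E c = trans
      (sum-cong-≋ {x = λ j → sign j * (r j * (D j + c * E j))} {y = λ j → f D j + c * f E j}
        λ j → rearrange (sign j) (r j) (D j) c (E j))
      (sum-linear (f D) (f E) c)
      where
      f : Vector Carrier _ → Vector Carrier _
      f D j = sign j * (r j * D j)
      rearrange : ∀ s r x c y → s * (r * (x + c * y)) ≈ s * (r * x) + c * (s * (r * y))
      rearrange = solve 5 (λ s r x c y → s :* (r :* (x :+ c :* y)) :=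
                                         s :* (r :* x) :+ c :* (s :* (r :* y))) refl

    expansion-zeroʳ : (r : Vector Carrier (suc n)) {D : Vector Carrier (suc n)} →
                      (∀ j → D j ≈ 0#) → expansion r D ≈ 0#
    expansion-zeroʳ r {D} D≈0 = sum-zero {f = λ j → sign j * (r j * D j)} λ j →
      trans (*-congˡ (trans (*-congˡ (D≈0 j)) (zeroʳ _))) (zeroʳ _)

    minors : (Fin n → Vector Carrier (suc n)) → Vector Carrier (suc n)
    minors M j = Δ (λ i k → M i (punchIn j k))

    minors-∷ : (a : Vector Carrier (suc (suc n))) (M : Fin n → Vector Carrier (suc (suc n))) → ∀ j →
               minors (a ∷ M) j ≈ Δ ((a ∘ punchIn j) ∷ λ i k → M i (punchIn j k))
    minors-∷ a M j = Δ-cong λ where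
      zero    k → refl
      (suc i) k → refl

  Δ-linear₀ : (a b : Vector Carrier (suc n)) (c : Carrier) (M : Fin n → Vector Carrier (suc n)) →
    Δ ((λ j → a j + c * b j) ∷ M) ≈ Δ (a ∷ M) + c * Δ (b ∷ M)
  Δ-linear₀ a b c M = begin
    Δ ((λ j → a j + c * b j) ∷ M)
      ≈⟨ Δ-expandRow ((λ j → a j + c * b j) ∷ M) ⟩
    expansion (λ j → a j + c * b j) (minors M)
      ≈⟨ expansion-linearˡ a b c (minors M) ⟩
    expansion a (minors M) + c * expansion b (minors M)
      ≈⟨ +-cong (Δ-expandRow (a ∷ M)) (*-congˡ (Δ-expandRow (b ∷ M))) ⟨
    Δ (a ∷ M) + c * Δ (b ∷ M) ∎

  Δ-linear₁ : (r a b : Vector Carrier (suc (suc n))) (c : Carrier)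
              (M : Fin n → Vector Carrier (suc (suc n))) →
    Δ (r ∷ (λ j → a j + c * b j) ∷ M) ≈ Δ (r ∷ a ∷ M) + c * Δ (r ∷ b ∷ M)
  Δ-linear₁ r a b c M = begin
    Δ (r ∷ a+cb ∷ M)
      ≈⟨ Δ-expandRow (r ∷ a+cb ∷ M) ⟩
    expansion r (minors (a+cb ∷ M))
      ≈⟨ expansion-congʳ r (λ j → begin
           minors (a+cb ∷ M) j
             ≈⟨ minors-∷ a+cb M j ⟩
           Δ ((a+cb ∘ punchIn j) ∷ λ i k → M i (punchIn j k))
             ≈⟨ Δ-linear₀ (a ∘ punchIn j) (b ∘ punchIn j) c (λ i k → M i (punchIn j k)) ⟩
           Δ ((a ∘ punchIn j) ∷ λ i k → M i (punchIn j k)) +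
             c * Δ ((b ∘ punchIn j) ∷ λ i k → M i (punchIn j k))
             ≈⟨ +-cong (minors-∷ a M j) (*-congˡ (minors-∷ b M j)) ⟨
           minors (a ∷ M) j + c * minors (b ∷ M) j ∎) ⟩
    expansion r (λ j → minors (a ∷ M) j + c * minors (b ∷ M) j)
      ≈⟨ expansion-linearʳ r (minors (a ∷ M)) (minors (b ∷ M)) c ⟩
    expansion r (minors (a ∷ M)) + c * expansion r (minors (b ∷ M))
      ≈⟨ +-cong (Δ-expandRow (r ∷ a ∷ M)) (*-congˡ (Δ-expandRow (r ∷ b ∷ M))) ⟨
    Δ (r ∷ a ∷ M) + c * Δ (r ∷ b ∷ M) ∎
    where
    a+cb : Vector Carrier _
    a+cb j = a j + c * b j

  -- Expansion along the first column keeps the two equal rows together: the first two terms have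
  -- equal minors and opposite signs, and every later minor again starts with two equal rows.
  Δ-alternating₀₁ : (a : Vector Carrier (suc (suc n))) (M : Fin n → Vector Carrier (suc (suc n))) →
    Δ (a ∷ a ∷ M) ≈ 0#
  Δ-alternating₀₁ {n} a M = begin
    Δ (a ∷ a ∷ M)
      ≈⟨ Δ-expandColumn (a ∷ a ∷ M) ⟩
    1# * (a zero * Δ (λ k l → (a ∷ a ∷ M) (suc k) (suc l))) + ((- 1# * 1#) *
      (a zero * Δ (λ k l → (a ∷ a ∷ M) (punchIn (suc zero) k) (suc l))) +
      sum λ i → sign (suc (suc i)) * (M i zero * Δ (λ k l → (a ∷ a ∷ M) (punchIn (suc (suc i)) k) (suc l))))
      ≈⟨ +-congˡ (+-cong
           (*-congˡ (*-congˡ (Δ-cong λ where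
             zero    l → refl
             (suc k) l → refl)))
           (sum-zero λ i → trans
             (*-congˡ {sign (suc (suc i))} (trans (*-congˡ {M i zero} (rest a M i)) (zeroʳ _)))
             (zeroʳ _))) ⟩
    1# * (a zero * d) + ((- 1# * 1#) * (a zero * d) + 0#)
      ≈⟨ solve 1 (λ x → con (+ 1) :* x :+ ((:- con (+ 1) :* con (+ 1)) :* x :+ con (+ 0))
                        := con (+ 0)) refl (a zero * d) ⟩
    0# ∎
    where
    d = Δ (λ k l → (a ∷ a ∷ M) (suc k) (suc l))
    rest : ∀ {n} a (M : Fin n → Vector Carrier (suc (suc n))) i →
           Δ (λ k l → (a ∷ a ∷ M) (punchIn (suc (suc i)) k) (suc l)) ≈ 0#
    rest {suc n} a M i = trans
      (Δ-cong λ where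
        zero          l → refl
        (suc zero)    l → refl
        (suc (suc k)) l → refl)
      (Δ-alternating₀₁ (a ∘ suc) λ k l → M (punchIn i k) (suc l))

  -- Polarization of `Δ-alternating₀₁` at `a + b`. The sum is written with a coefficient `1#` to
  -- match the shape of the linearity lemmas.
  Δ-swap₀₁ : (a b : Vector Carrier (suc (suc n))) (M : Fin n → Vector Carrier (suc (suc n))) →
    Δ (a ∷ b ∷ M) ≈ - Δ (b ∷ a ∷ M)
  Δ-swap₀₁ a b M = trans (unique _ _ (begin
    Δ (a ∷ b ∷ M) + Δ (b ∷ a ∷ M)
      ≈⟨ +-cong (simplifyʳ _) (simplifyˡ _) ⟨
    (0# + 1# * Δ (a ∷ b ∷ M)) + 1# * (Δ (b ∷ a ∷ M) + 1# * 0#)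
      ≈⟨ +-cong (+-congʳ (Δ-alternating₀₁ a M))
                (*-congˡ (+-congˡ (*-congˡ (Δ-alternating₀₁ b M)))) ⟨
    (Δ (a ∷ a ∷ M) + 1# * Δ (a ∷ b ∷ M)) + 1# * (Δ (b ∷ a ∷ M) + 1# * Δ (b ∷ b ∷ M))
      ≈⟨ +-cong (Δ-linear₁ a a b 1# M) (*-congˡ (Δ-linear₁ b a b 1# M)) ⟨
    Δ (a ∷ a+b ∷ M) + 1# * Δ (b ∷ a+b ∷ M)
      ≈⟨ Δ-linear₀ a b 1# (a+b ∷ M) ⟨
    Δ (a+b ∷ a+b ∷ M)
      ≈⟨ Δ-alternating₀₁ a+b M ⟩
    0# ∎)) refl
    where
    a+b : Vector Carrier _
    a+b j = a j + 1# * b j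
    simplifyʳ : ∀ x → 0# + 1# * x ≈ x
    simplifyʳ = solve 1 (λ x → con (+ 0) :+ con (+ 1) :* x := x) refl
    simplifyˡ : ∀ x → 1# * (x + 1# * 0#) ≈ x
    simplifyˡ = solve 1 (λ x → con (+ 1) :* (x :+ con (+ 1) :* con (+ 0)) := x) refl
    unique : ∀ x y → x + y ≈ 0# → x ≈ - y
    unique x y eq = begin
      x             ≈⟨ solve 2 (λ x y → x := (x :+ y) :- y) refl x y ⟩
      (x + y) - y   ≈⟨ +-congʳ eq ⟩
      0# - y        ≈⟨ +-identityˡ _ ⟩
      - y           ∎

  -- A repeated row further down is reached by swapping the first two rows and expanding along
  -- `M zero`: each minor then starts with a copy of one of its later rows, with index smaller by
  -- one.
  Δ-alternating₀ : (M : Fin n → Vector Carrier (suc n)) (l : Fin n) → Δ (M l ∷ M) ≈ 0#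
  Δ-alternating₀ {suc n} M zero = trans
    (Δ-cong λ where
      zero          j → refl
      (suc zero)    j → refl
      (suc (suc i)) j → refl)
    (Δ-alternating₀₁ (M zero) (M ∘ suc))
  Δ-alternating₀ {suc n} M (suc l) = begin
    Δ (M (suc l) ∷ M)
      ≈⟨ (Δ-cong λ where
           zero          j → refl
           (suc zero)    j → refl
           (suc (suc i)) j → refl) ⟩
    Δ (M (suc l) ∷ M zero ∷ M ∘ suc)
      ≈⟨ Δ-swap₀₁ (M (suc l)) (M zero) (M ∘ suc) ⟩
    - Δ (M zero ∷ M (suc l) ∷ M ∘ suc)
      ≈⟨ -‿cong (trans (Δ-expandRow _) (expansion-zeroʳ (M zero) λ j → trans
           (minors-∷ (M (suc l)) (M ∘ suc) j)
           (Δ-alternating₀ (λ i k → M (suc i) (punchIn j k)) l))) ⟩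
    - 0#
      ≈⟨ -0#≈0# ⟩
    0# ∎

  -- The selector `r` separates the number of summands from the number of rows, so that the
  -- induction on `m` leaves `M` unchanged.
  Δ-addToRow₀ : (a : Vector Carrier (suc n)) (M : Fin n → Vector Carrier (suc n))
    {m : ℕ} (x : Vector Carrier m) (r : Fin m → Fin n) →
    Δ ((λ j → a j + sum (λ l → x l * M (r l) j)) ∷ M) ≈ Δ (a ∷ M)
  Δ-addToRow₀ a M {zero}  x r = Δ-cong λ where
    zero    j → +-identityʳ _
    (suc i) j → refl
  Δ-addToRow₀ a M {suc m} x r = begin
    Δ ((λ j → a j + sum (λ l → x l * M (r l) j)) ∷ M)
      ≈⟨ (Δ-cong λ where
           zero    j → regroup (a j) (x zero * M (r zero) j) _
           (suc i) j → refl) ⟩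
    Δ ((λ j → (a j + sum (λ l → x (suc l) * M (r (suc l)) j)) + x zero * M (r zero) j) ∷ M)
      ≈⟨ Δ-linear₀ _ (M (r zero)) (x zero) M ⟩
    Δ ((λ j → a j + sum (λ l → x (suc l) * M (r (suc l)) j)) ∷ M) + x zero * Δ (M (r zero) ∷ M)
      ≈⟨ +-cong (Δ-addToRow₀ a M (x ∘ suc) (r ∘ suc)) (*-congˡ (Δ-alternating₀ M (r zero))) ⟩
    Δ (a ∷ M) + x zero * 0#
      ≈⟨ solve 2 (λ d x → d :+ x :* con (+ 0) := d) refl _ _ ⟩
    Δ (a ∷ M) ∎
    where
    regroup : ∀ a b c → a + (b + c) ≈ (a + c) + b
    regroup = solve 3 (λ a b c → a :+ (b :+ c) := (a :+ c) :+ b) refl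

  -- Row 1 is cleaned by linearity and alternation. Swapping it to the top and expanding along it
  -- makes `a` the first row of every minor, where the induction hypothesis cleans the remaining
  -- rows.
  Δ-addRow₀ : (a : Vector Carrier (suc n)) (M : Fin n → Vector Carrier (suc n))
    (y : Vector Carrier n) → Δ (a ∷ λ i j → M i j + y i * a j) ≈ Δ (a ∷ M)
  Δ-addRow₀ {zero}  a M y = Δ-cong λ where zero j → refl
  Δ-addRow₀ {suc n} a M y = begin
    Δ (a ∷ M+ya)
      ≈⟨ cons M+ya ⟩
    Δ (a ∷ M+ya zero ∷ M+ya ∘ suc)
      ≈⟨ Δ-linear₁ a (M zero) a (y zero) (M+ya ∘ suc) ⟩
    Δ (a ∷ M zero ∷ M+ya ∘ suc) + y zero * Δ (a ∷ a ∷ M+ya ∘ suc)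
      ≈⟨ +-cong (Δ-swap₀₁ a (M zero) _) (*-congˡ (Δ-alternating₀₁ a _)) ⟩
    - Δ (M zero ∷ a ∷ M+ya ∘ suc) + y zero * 0#
      ≈⟨ solve 2 (λ d x → d :+ x :* con (+ 0) := d) refl _ _ ⟩
    - Δ (M zero ∷ a ∷ M+ya ∘ suc)
      ≈⟨ -‿cong (Δ-expandRow (M zero ∷ a ∷ M+ya ∘ suc)) ⟩
    - expansion (M zero) (minors (a ∷ M+ya ∘ suc))
      ≈⟨ -‿cong (expansion-congʳ (M zero) λ j → begin
           minors (a ∷ M+ya ∘ suc) j
             ≈⟨ minors-∷ a (M+ya ∘ suc) j ⟩
           Δ ((a ∘ punchIn j) ∷ λ i k → M+ya (suc i) (punchIn j k))
             ≈⟨ Δ-addRow₀ (a ∘ punchIn j) (λ i k → M (suc i) (punchIn j k)) (y ∘ suc) ⟩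
           Δ ((a ∘ punchIn j) ∷ λ i k → M (suc i) (punchIn j k))
             ≈⟨ minors-∷ a (M ∘ suc) j ⟨
           minors (a ∷ M ∘ suc) j ∎) ⟩
    - expansion (M zero) (minors (a ∷ M ∘ suc))
      ≈⟨ -‿cong (Δ-expandRow (M zero ∷ a ∷ M ∘ suc)) ⟨
    - Δ (M zero ∷ a ∷ M ∘ suc)
      ≈⟨ Δ-swap₀₁ a (M zero) _ ⟨
    Δ (a ∷ M zero ∷ M ∘ suc)
      ≈⟨ cons M ⟨
    Δ (a ∷ M) ∎
    where
    M+ya : Vector (Vector Carrier (suc (suc n))) (suc n)
    M+ya i j = M i j + y i * a j
    cons : ∀ N → Δ (a ∷ N) ≈ Δ (a ∷ N zero ∷ N ∘ suc)
    cons N = Δ-cong λ where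
      zero          j → refl
      (suc zero)    j → refl
      (suc (suc i)) j → refl

  -- Conjugating by the unipotent matrix with first column (1 , x) splits
  -- off the eigenvalue μ.
  Δ-deflate : (M : Matrix (suc n)) (x : Vector Carrier n) (μ : Carrier) →
    (M *ᵛ (1# ∷ x)) ≈ᵛ (μ ·ᵛ (1# ∷ x)) →
    Δ M ≈ μ * Δ (λ i j → M (suc i) (suc j) - x i * M zero (suc j))
  Δ-deflate {n} M x μ Mx≈μx = begin
    Δ M
      -- The row operations modify the first row, so the first column is handled as a row of the
      -- transpose.
      ≈⟨ Δ-transpose M ⟨
    Δ (transpose M)
      ≈⟨ (Δ-cong λ where
           zero    j → refl
           (suc i) j → refl) ⟩
    Δ (M₀ ∷ Mᵀ)
      -- Adding the other columns with coefficients `x` turns the first column into `M` applied to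
      -- `(1 , x)`, that is, into `μ` times that vector.
      ≈⟨ Δ-addToRow₀ M₀ Mᵀ x (λ l → l) ⟨
    Δ ((λ j → M₀ j + sum (λ l → x l * Mᵀ l j)) ∷ Mᵀ)
      ≈⟨ (Δ-cong λ where
           zero    j → trans (eigen j) (sym (+-identityˡ _))
           (suc i) j → refl) ⟩
    Δ ((λ j → 0# + μ * (1# ∷ x) j) ∷ Mᵀ)
      ≈⟨ Δ-linear₀ (λ _ → 0#) (1# ∷ x) μ Mᵀ ⟩
    Δ ((λ _ → 0#) ∷ Mᵀ) + μ * Δ ((1# ∷ x) ∷ Mᵀ)
      ≈⟨ +-cong (trans (Δ-expandRow ((λ _ → 0#) ∷ Mᵀ))
           (sum-zero {f = λ j → sign j * (0# * minors Mᵀ j)} λ j →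
             trans (*-congˡ {sign j} (zeroˡ _)) (zeroʳ _))) (*-congˡ (begin
           Δ ((1# ∷ x) ∷ Mᵀ)
             ≈⟨ Δ-transpose ((1# ∷ x) ∷ Mᵀ) ⟨
           Δ (transpose ((1# ∷ x) ∷ Mᵀ))
             ≈⟨ (Δ-cong λ where
                  zero    zero    → refl
                  zero    (suc j) → refl
                  (suc i) zero    → refl
                  (suc i) (suc j) → refl) ⟩
           Δ (row ∷ λ i → x i ∷ M (suc i) ∘ suc)
             -- With `μ` extracted, the first column is `(1 , x)`; subtracting `x i` times the first
             -- row clears it below the corner.
             ≈⟨ Δ-addRow₀ row (λ i → x i ∷ M (suc i) ∘ suc) (λ i → - x i) ⟨
           Δ N
             ≈⟨ Δ-expandColumn N ⟩
           1# * (1# * Δ (λ i j → N (suc i) (suc j))) +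
             sum (λ i → sign (suc i) * (N (suc i) zero * Δ (λ k l → N (punchIn (suc i) k) (suc l))))
             ≈⟨ +-cong (trans (*-identityˡ _) (*-identityˡ _)) (sum-zero λ i → trans
                  (*-congˡ {sign (suc i)} (trans (*-congʳ (vanish (x i))) (zeroˡ _))) (zeroʳ _)) ⟩
           Δ (λ i j → N (suc i) (suc j)) + 0#
             ≈⟨ +-identityʳ _ ⟩
           Δ (λ i j → N (suc i) (suc j))
             ≈⟨ (Δ-cong λ i j → solve 3 (λ a b c → a :+ (:- b) :* c := a :- b :* c) refl _ _ _) ⟩
           Δ (λ i j → M (suc i) (suc j) - x i * M zero (suc j)) ∎)) ⟩
    0# + μ * Δ (λ i j → M (suc i) (suc j) - x i * M zero (suc j))
      ≈⟨ +-identityˡ _ ⟩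
    μ * Δ (λ i j → M (suc i) (suc j) - x i * M zero (suc j)) ∎
    where
    M₀ : Vector Carrier (suc n)
    M₀ j = M j zero
    Mᵀ : Vector (Vector Carrier (suc n)) n
    Mᵀ l j = M j (suc l)
    row : Vector Carrier (suc n)
    row = 1# ∷ M zero ∘ suc
    N : Matrix (suc n)
    N = row ∷ λ i j → (x i ∷ M (suc i) ∘ suc) j + (- x i) * row j
    vanish : ∀ x → x + (- x) * 1# ≈ 0#
    vanish = solve 1 (λ x → x :+ (:- x) :* con (+ 1) := con (+ 0)) refl
    eigen : ∀ j → M₀ j + sum (λ l → x l * Mᵀ l j) ≈ μ * (1# ∷ x) j
    eigen j = trans
      (+-cong (sym (*-identityʳ _)) (sum-cong-≋ λ l → *-comm (x l) _))
      (Mx≈μx j)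

  det-cong : {A B : Matrix n} → A ≈ᴹ B → det A ≈ det B
  det-cong A≈B = trans (sym (Δ≈det _)) (trans (Δ-cong A≈B) (Δ≈det _))

  det-deflate : (M : Matrix (suc n)) (x : Vector Carrier n) (μ : Carrier) →
    (M *ᵛ (1# ∷ x)) ≈ᵛ (μ ·ᵛ (1# ∷ x)) →
    det M ≈ μ * det (λ i j → M (suc i) (suc j) - x i * M zero (suc j))
  det-deflate M x μ Mx≈μx =
    trans (sym (Δ≈det M)) (trans (Δ-deflate M x μ Mx≈μx) (*-congˡ (Δ≈det _)))

-- Inverses and cancellation in a field

module FieldProperties {a} (em : ExcludedMiddle a) (F : Field a) where
  open FieldOperations F
  open Inverse em F
  open CommutativeRing commutativeRing using (ring)
  open RingProperties ring using (-0#≈0#)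
  open IntegerSolver commutativeRing
  open ≈-Reasoning setoid

  private
    x-0≈x : ∀ x → x - 0# ≈ x
    x-0≈x x = trans (+-congˡ -0#≈0#) (+-identityʳ x)

  ⁻¹-inverseʳ : ∀ {x} → x ≉ 0# → x * x ⁻¹ ≈ 1#
  ⁻¹-inverseʳ {x} x≉0 with em {P = x # 0#}
  ... | yes x#0 = trans (*-congʳ (sym (x-0≈x x))) (proj₂ (proj₂ (#⇒invertible x#0)))
  ... | no ¬x#0 = contradiction (proj₁ (tight x 0#) ¬x#0) x≉0

  ⁻¹-inverseˡ : ∀ {x} → x ≉ 0# → x ⁻¹ * x ≈ 1#
  ⁻¹-inverseˡ x≉0 = trans (*-comm _ _) (⁻¹-inverseʳ x≉0)

  ⁻¹-zero : ∀ {x} → x ≈ 0# → x ⁻¹ ≈ 0#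
  ⁻¹-zero {x} x≈0 with em {P = x # 0#}
  ... | yes x#0 = contradiction x#0 (proj₂ (tight x 0#) x≈0)
  ... | no  _   = refl

  1≉0 : 1# ≉ 0#
  1≉0 1≈0 = proj₂ (tight 1# 0#) 1≈0
    (invertible⇒# (1# , trans (*-identityˡ _) (x-0≈x 1#) , trans (*-identityʳ _) (x-0≈x 1#)))

  *-cancelˡ : ∀ {x y z} → x ≉ 0# → x * y ≈ x * z → y ≈ z
  *-cancelˡ {x} {y} {z} x≉0 xy≈xz = begin
    y                ≈⟨ *-identityˡ y ⟨
    1# * y           ≈⟨ *-congʳ (⁻¹-inverseˡ x≉0) ⟨
    x ⁻¹ * x * y     ≈⟨ *-assoc _ _ _ ⟩
    x ⁻¹ * (x * y)   ≈⟨ *-congˡ xy≈xz ⟩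
    x ⁻¹ * (x * z)   ≈⟨ *-assoc _ _ _ ⟨
    x ⁻¹ * x * z     ≈⟨ *-congʳ (⁻¹-inverseˡ x≉0) ⟩
    1# * z           ≈⟨ *-identityˡ z ⟩
    z                ∎

  *-zero-product : ∀ {x y} → x ≉ 0# → x * y ≈ 0# → y ≈ 0#
  *-zero-product x≉0 xy≈0 = *-cancelˡ x≉0 (trans xy≈0 (sym (zeroʳ _)))

-- Order and geometric decay in the reals

module RealProperties {a} (em : ExcludedMiddle a) (ℝ : Reals a) where
  open Reals ℝ hiding (zero)
  open Inverse em realField
  open FieldProperties em realField
  open StrictTotalOrder strictTotalOrder public
    using (compare; strictPartialOrder; <-respˡ-≈; <-respʳ-≈)
    renaming (trans to <-trans; irrefl to <-irrefl)
  open DecTotalOrder decTotalOrder public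
    using (≤-respˡ-≈; ≤-respʳ-≈)
    renaming (refl to ≤-refl; trans to ≤-trans; reflexive to ≤-reflexive;
              antisym to ≤-antisym; total to ≤-total)
  open <-Reasoning strictPartialOrder
  open IntegerSolver commutativeRing

  <⇒≤ : ∀ {x y} → x < y → x ≤ y
  <⇒≤ = inj₁

  <-≤-trans : ∀ {x y z} → x < y → y ≤ z → x < z
  <-≤-trans x<y (inj₁ y<z) = <-trans x<y y<z
  <-≤-trans x<y (inj₂ y≈z) = <-respʳ-≈ y≈z x<y

  ≤-<-trans : ∀ {x y z} → x ≤ y → y < z → x < z
  ≤-<-trans (inj₁ x<y) y<z = <-trans x<y y<z
  ≤-<-trans (inj₂ x≈y) y<z = <-respˡ-≈ (sym x≈y) y<z

  <⇒≱ : ∀ {x y} → x < y → ¬ y ≤ x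
  <⇒≱ x<y y≤x = <-irrefl refl (<-≤-trans x<y y≤x)

  ≮⇒≥ : ∀ {x y} → ¬ x < y → y ≤ x
  ≮⇒≥ {x} {y} x≮y with compare x y
  ... | tri< x<y _ _ = contradiction x<y x≮y
  ... | tri≈ _ x≈y _ = inj₂ (sym x≈y)
  ... | tri> _ _ y<x = inj₁ y<x

  <⇒≉ : ∀ {x} → 0# < x → x ≉ 0#
  <⇒≉ 0<x x≈0 = <-irrefl (sym x≈0) 0<x

  ≤∧≉⇒< : ∀ {x} → 0# ≤ x → x ≉ 0# → 0# < x
  ≤∧≉⇒< (inj₁ 0<x) x≉0 = 0<x
  ≤∧≉⇒< (inj₂ 0≈x) x≉0 = contradiction (sym 0≈x) x≉0

  *-monoʳ-< : ∀ {x y z} → 0# < x → y < z → x * y < x * z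
  *-monoʳ-< {x} {y} {z} 0<x y<z = begin-strict
    x * y                       ≈⟨ +-identityʳ _ ⟨
    x * y + 0#                  <⟨ +-monoʳ-< (x * y) (*-positive 0<x 0<z-y) ⟩
    x * y + x * (- y + z)       ≈⟨ solve 3 (λ x y z → x :* y :+ x :* (:- y :+ z) := x :* z) refl x y z ⟩
    x * z                       ∎
    where
    0<z-y : 0# < - y + z
    0<z-y = <-respˡ-≈ (-‿inverseˡ y) (+-monoʳ-< (- y) y<z)

  *-monoʳ-≤ : ∀ {x y z} → 0# ≤ x → y ≤ z → x * y ≤ x * z
  *-monoʳ-≤ _          (inj₂ y≈z) = inj₂ (*-congˡ y≈z)
  *-monoʳ-≤ (inj₁ 0<x) (inj₁ y<z) = inj₁ (*-monoʳ-< 0<x y<z)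
  *-monoʳ-≤ (inj₂ 0≈x) (inj₁ y<z) = inj₂ (trans (zero-product _) (sym (zero-product _)))
    where
    zero-product : ∀ y → _ * y ≈ 0#
    zero-product y = trans (*-congʳ (sym 0≈x)) (zeroˡ y)

  *-monoˡ-≤ : ∀ {x y z} → 0# ≤ x → y ≤ z → y * x ≤ z * x
  *-monoˡ-≤ {x} {y} {z} 0≤x y≤z = begin
    y * x   ≈⟨ *-comm y x ⟩
    x * y   ≤⟨ *-monoʳ-≤ 0≤x y≤z ⟩
    x * z   ≈⟨ *-comm x z ⟩
    z * x   ∎

  *-monoˡ-< : ∀ {x y z} → 0# < x → y < z → y * x < z * x
  *-monoˡ-< {x} {y} {z} 0<x y<z = begin-strict
    y * x   ≈⟨ *-comm y x ⟩
    x * y   <⟨ *-monoʳ-< 0<x y<z ⟩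
    x * z   ≈⟨ *-comm x z ⟩
    z * x   ∎

  *-mono-≤ : ∀ {x y u v} → 0# ≤ u → 0# ≤ y → x ≤ y → u ≤ v → x * u ≤ y * v
  *-mono-≤ 0≤u 0≤y x≤y u≤v = ≤-trans (*-monoˡ-≤ 0≤u x≤y) (*-monoʳ-≤ 0≤y u≤v)

  *-nonneg : ∀ {x y} → 0# ≤ x → 0# ≤ y → 0# ≤ x * y
  *-nonneg 0≤x 0≤y = ≤-trans (inj₂ (sym (zeroʳ _))) (*-monoʳ-≤ 0≤x 0≤y)

  *-cancelˡ-< : ∀ {x y z} → 0# ≤ x → x * y < x * z → y < z
  *-cancelˡ-< {x} {y} {z} 0≤x xy<xz with compare y z
  ... | tri< y<z _ _ = y<z
  ... | tri≈ _ y≈z _ = contradiction xy<xz (<-irrefl (*-congˡ y≈z))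
  ... | tri> _ _ z<y = contradiction (*-monoʳ-≤ 0≤x (<⇒≤ z<y)) (<⇒≱ xy<xz)

  *-cancelˡ-≤ : ∀ {x y z} → 0# < x → x * y ≤ x * z → y ≤ z
  *-cancelˡ-≤ 0<x xy≤xz = ≮⇒≥ λ z<y → <⇒≱ (*-monoʳ-< 0<x z<y) xy≤xz

  0<1 : 0# < 1#
  0<1 with compare 0# 1#
  ... | tri< 0<1 _ _ = 0<1
  ... | tri≈ _ 0≈1 _ = contradiction (sym 0≈1) 1≉0
  ... | tri> _ _ 1<0 = begin-strict
    0#           <⟨ *-positive 0<-1 0<-1 ⟩
    - 1# * - 1#  ≈⟨ solve 0 (:- con (+ 1) :* :- con (+ 1) := con (+ 1)) refl ⟩
    1#           ∎
    where
    0<-1 : 0# < - 1#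
    0<-1 = begin-strict
      0#         ≈⟨ -‿inverseˡ 1# ⟨
      - 1# + 1#  <⟨ +-monoʳ-< (- 1#) 1<0 ⟩
      - 1# + 0#  ≈⟨ +-identityʳ _ ⟩
      - 1#       ∎

  ⁻¹-positive : ∀ {x} → 0# < x → 0# < x ⁻¹
  ⁻¹-positive {x} 0<x = *-cancelˡ-< (<⇒≤ 0<x) (begin-strict
    x * 0#     ≈⟨ zeroʳ x ⟩
    0#         <⟨ 0<1 ⟩
    1#         ≈⟨ ⁻¹-inverseʳ (<⇒≉ 0<x) ⟨
    x * x ⁻¹   ∎)

  ^-nonneg : ∀ {x} → 0# ≤ x → ∀ k → 0# ≤ x ^ k
  ^-nonneg 0≤x zero    = <⇒≤ 0<1
  ^-nonneg 0≤x (suc k) = *-nonneg 0≤x (^-nonneg 0≤x k)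

  ^-positive : ∀ {x} → 0# < x → ∀ k → 0# < x ^ k
  ^-positive 0<x zero    = 0<1
  ^-positive 0<x (suc k) = *-positive 0<x (^-positive 0<x k)

  ^-antitone : ∀ {x} → 0# ≤ x → x ≤ 1# → ∀ {j k} → j ℕ.≤ k → x ^ k ≤ x ^ j
  ^-antitone {x} 0≤x x≤1 {k = zero}  ℕ.z≤n       = ≤-refl
  ^-antitone {x} 0≤x x≤1 {k = suc k} ℕ.z≤n       = begin
    x * x ^ k   ≤⟨ *-mono-≤ (^-nonneg 0≤x k) (<⇒≤ 0<1) x≤1 (^-antitone 0≤x x≤1 {k = k} ℕ.z≤n) ⟩
    1# * 1#     ≈⟨ *-identityˡ 1# ⟩
    1#          ∎
  ^-antitone     0≤x x≤1             (ℕ.s≤s j≤k) = *-monoʳ-≤ 0≤x (^-antitone 0≤x x≤1 j≤k)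

  -- The supremum s of the lower bounds of {C r ^ k} satisfies s ≤ r s.
  geometric-decay : ∀ {C r} → 0# ≤ C → 0# ≤ r → r < 1# → ∀ {ε} → 0# < ε →
                    ∃ λ N → ∀ k → N ℕ.≤ k → C * r ^ k < ε
  geometric-decay {C} {r} 0≤C 0≤r r<1 {ε} 0<ε with em {P = ∃ λ N → C * r ^ N < ε}
  ... | yes (N , Cr^N<ε) = N , λ k N≤k →
    ≤-<-trans (*-monoʳ-≤ 0≤C (^-antitone 0≤r (<⇒≤ r<1) N≤k)) Cr^N<ε
  ... | no ¬∃ = contradiction s≤rs (<⇒≱ rs<s)
    where
    LowerBound : Pred Carrier a
    LowerBound x = ∀ k → x ≤ C * r ^ k

    ε-lower : ε ∈ LowerBound
    ε-lower k = ≮⇒≥ λ Cr^k<ε → ¬∃ (k , Cr^k<ε)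

    sup : ∃ λ s → IsUpperBound LowerBound s × (∀ {b} → IsUpperBound LowerBound b → s ≤ b)
    sup = supremum LowerBound (ε , ε-lower) (C * 1# , λ x-lower → x-lower zero)

    s : Carrier
    s = proj₁ sup

    rs-upper : IsUpperBound LowerBound (r * s)
    rs-upper {x} x-lower with compare 0# r
    ... | tri> _ _ r<0 = contradiction 0≤r (<⇒≱ r<0)
    -- There is no inverse of `r` to shift the bounds with, but the bound at exponent 1 already
    -- forces `x ≤ 0`.
    ... | tri≈ _ 0≈r _ = begin
      x               ≤⟨ x-lower 1 ⟩
      C * (r * 1#)    ≈⟨ *-congˡ (trans (*-congʳ (sym 0≈r)) (zeroˡ _)) ⟩
      C * 0#          ≈⟨ zeroʳ C ⟩
      0#              ≈⟨ zeroˡ s ⟨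
      0# * s          ≈⟨ *-congʳ 0≈r ⟩
      r * s           ∎
    ... | tri< 0<r _ _ = begin
      x               ≈⟨ *-identityˡ x ⟨
      1# * x          ≈⟨ *-congʳ (⁻¹-inverseʳ (<⇒≉ 0<r)) ⟨
      r * r ⁻¹ * x    ≈⟨ *-assoc _ _ _ ⟩
      r * (r ⁻¹ * x)  ≤⟨ *-monoʳ-≤ 0≤r (proj₁ (proj₂ sup) r⁻¹x-lower) ⟩
      r * s           ∎
      where
      -- The sequence shifted by one place is `r` times itself, so a lower bound may be divided by
      -- `r`.
      r⁻¹x-lower : r ⁻¹ * x ∈ LowerBound
      r⁻¹x-lower k = begin
        r ⁻¹ * x                    ≤⟨ *-monoʳ-≤ (<⇒≤ (⁻¹-positive 0<r)) (x-lower (suc k)) ⟩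
        r ⁻¹ * (C * (r * r ^ k))    ≈⟨ solve 4 (λ i C r p → i :* (C :* (r :* p)) := (i :* r) :* (C :* p))
                                         refl (r ⁻¹) C r (r ^ k) ⟩
        (r ⁻¹ * r) * (C * r ^ k)    ≈⟨ *-congʳ (⁻¹-inverseˡ (<⇒≉ 0<r)) ⟩
        1# * (C * r ^ k)            ≈⟨ *-identityˡ _ ⟩
        C * r ^ k                   ∎

    s≤rs : s ≤ r * s
    s≤rs = proj₂ (proj₂ sup) rs-upper

    -- Strictness requires `s` to be positive, which holds because `ε` is among the lower bounds.
    rs<s : r * s < s
    rs<s = <-respʳ-≈ (*-identityˡ s)
      (*-monoˡ-< (<-≤-trans 0<ε (proj₁ (proj₂ sup) ε-lower)) r<1)

module RealArithmetic {a} (em : ExcludedMiddle a) (ℝ : Reals a) where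
  open Reals ℝ public
  open RealProperties em ℝ public
  open Inverse em realField public
  open FieldProperties em realField public
  open Max totalOrder public using (x≤x⊔y; x≤y⊔x) renaming (⊔-lub to max-lub)
  open Exp (CommutativeRing.semiring commutativeRing) public using (^-congˡ; ^-homo-*)

-- Ultrametric estimates and the contraction principle

module NonArchimedeanProperties {a} (em : ExcludedMiddle a) {ℝ : Reals a}
  (K : NonArchimedeanField ℝ) where
  open NonArchimedeanField K hiding (zero)
  open FieldProperties em baseField
  open Inverse em baseField using (_⁻¹)
  open Sum (CommutativeRing.semiring commutativeRing) using
    (sum; sum-cong-≋; *-distribˡ-sum; ∑-distrib-+; sum-replicate)
  open RingProperties (CommutativeRing.ring commutativeRing) using (-1*x≈-x; x∙y⁻¹≈ε⇒x≈y)
  open IntegerSolver commutativeRing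

  private
    module ℝ = RealArithmetic em ℝ

  module ℝ-Reasoning = <-Reasoning ℝ.strictPartialOrder
  module K-Reasoning = ≈-Reasoning setoid

  ∣∣-positive : ∀ {x} → x ≉ 0# → ℝ.0# ℝ.< ∣ x ∣
  ∣∣-positive {x} x≉0 = ℝ.≤∧≉⇒< (∣∣-nonneg x) (x≉0 ∘ ∣∣-definite)

  ∣∣-positive⁻¹ : ∀ {x} → ℝ.0# ℝ.< ∣ x ∣ → x ≉ 0#
  ∣∣-positive⁻¹ 0<∣x∣ x≈0 = ℝ.<-irrefl (ℝ.sym (ℝ.trans (∣∣-cong x≈0) ∣0∣)) 0<∣x∣

  ∣1∣ : ∣ 1# ∣ ℝ.≈ ℝ.1#
  ∣1∣ = ℝ.*-cancelˡ (ℝ.<⇒≉ (∣∣-positive 1≉0))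
    (ℝ.trans (ℝ.sym (∣∣-* 1# 1#)) (ℝ.trans (∣∣-cong (*-identityˡ 1#)) (ℝ.sym (ℝ.*-identityʳ _))))

  private
    square≈1 : ∀ {x} → ℝ.0# ℝ.≤ x → x ℝ.* x ℝ.≈ ℝ.1# → x ℝ.≈ ℝ.1#
    square≈1 {x} 0≤x xx≈1 with ℝ.compare x ℝ.1#
    ... | tri≈ _ x≈1 _ = x≈1
    ... | tri< x<1 _ _ = contradiction (begin-strict
      ℝ.1#         ≈⟨ xx≈1 ⟨
      x ℝ.* x      ≤⟨ ℝ.*-monoʳ-≤ 0≤x (ℝ.<⇒≤ x<1) ⟩
      x ℝ.* ℝ.1#   ≈⟨ ℝ.*-identityʳ x ⟩
      x            <⟨ x<1 ⟩
      ℝ.1#         ∎) (ℝ.<-irrefl ℝ.refl)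
      where open ℝ-Reasoning
    ... | tri> _ _ 1<x = contradiction (begin-strict
      ℝ.1#         <⟨ 1<x ⟩
      x            ≈⟨ ℝ.*-identityʳ x ⟨
      x ℝ.* ℝ.1#   <⟨ ℝ.*-monoʳ-< (ℝ.<-trans ℝ.0<1 1<x) 1<x ⟩
      x ℝ.* x      ≈⟨ xx≈1 ⟩
      ℝ.1#         ∎) (ℝ.<-irrefl ℝ.refl)
      where open ℝ-Reasoning

  ∣-1∣ : ∣ - 1# ∣ ℝ.≈ ℝ.1#
  ∣-1∣ = square≈1 (∣∣-nonneg _) (ℝ.trans (ℝ.sym (∣∣-* (- 1#) (- 1#)))
    (ℝ.trans (∣∣-cong (solve 0 (:- con (+ 1) :* :- con (+ 1) := con (+ 1)) refl)) ∣1∣))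

  ∣-x∣ : ∀ x → ∣ - x ∣ ℝ.≈ ∣ x ∣
  ∣-x∣ x = begin-equality
    ∣ - x ∣               ≈⟨ ∣∣-cong (-1*x≈-x x) ⟨
    ∣ - 1# * x ∣          ≈⟨ ∣∣-* (- 1#) x ⟩
    ∣ - 1# ∣ ℝ.* ∣ x ∣    ≈⟨ ℝ.*-congʳ ∣-1∣ ⟩
    ℝ.1# ℝ.* ∣ x ∣        ≈⟨ ℝ.*-identityˡ _ ⟩
    ∣ x ∣                 ∎
    where open ℝ-Reasoning

  ∣x-y∣≈∣y-x∣ : ∀ x y → ∣ x - y ∣ ℝ.≈ ∣ y - x ∣
  ∣x-y∣≈∣y-x∣ x y = ℝ.trans
    (∣∣-cong (solve 2 (λ x y → x :- y := :- (y :- x)) refl x y)) (∣-x∣ (y - x))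

  ∣^∣ : ∀ x k → ∣ x ^ k ∣ ℝ.≈ ∣ x ∣ ℝ.^ k
  ∣^∣ x zero    = ∣1∣
  ∣^∣ x (suc k) = ℝ.trans (∣∣-* x (x ^ k)) (ℝ.*-congˡ (∣^∣ x k))

  module _ {x y : Carrier} {r : ℝ.Carrier} where
    ∣+∣≤ : ∣ x ∣ ℝ.≤ r → ∣ y ∣ ℝ.≤ r → ∣ x + y ∣ ℝ.≤ r
    ∣+∣≤ ∣x∣≤r ∣y∣≤r = ℝ.≤-trans (∣∣-+ x y) (ℝ.max-lub ∣x∣≤r ∣y∣≤r)

    ∣+∣< : ∣ x ∣ ℝ.< r → ∣ y ∣ ℝ.< r → ∣ x + y ∣ ℝ.< r
    ∣+∣< ∣x∣<r ∣y∣<r with ℝ.≤-total ∣ x ∣ ∣ y ∣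
    ... | inj₁ ∣x∣≤∣y∣ = ℝ.≤-<-trans (ℝ.≤-trans (∣∣-+ x y) (ℝ.max-lub ∣x∣≤∣y∣ ℝ.≤-refl)) ∣y∣<r
    ... | inj₂ ∣y∣≤∣x∣ = ℝ.≤-<-trans (ℝ.≤-trans (∣∣-+ x y) (ℝ.max-lub ℝ.≤-refl ∣y∣≤∣x∣)) ∣x∣<r

  ∣-∣≤ : ∀ {x y r} → ∣ x ∣ ℝ.≤ r → ∣ y ∣ ℝ.≤ r → ∣ x - y ∣ ℝ.≤ r
  ∣-∣≤ ∣x∣≤r ∣y∣≤r = ∣+∣≤ ∣x∣≤r (ℝ.≤-respˡ-≈ (ℝ.sym (∣-x∣ _)) ∣y∣≤r)

  ∣x-z∣≤ : ∀ {x z r} y → ∣ x - y ∣ ℝ.≤ r → ∣ y - z ∣ ℝ.≤ r → ∣ x - z ∣ ℝ.≤ r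
  ∣x-z∣≤ {x} {z} y ∣x-y∣≤r ∣y-z∣≤r = ℝ.≤-respˡ-≈
    (∣∣-cong (solve 3 (λ x y z → (x :- y) :+ (y :- z) := x :- z) refl x y z))
    (∣+∣≤ ∣x-y∣≤r ∣y-z∣≤r)

  ∣*∣≤ : ∀ {x y r s} → ∣ x ∣ ℝ.≤ r → ∣ y ∣ ℝ.≤ s → ∣ x * y ∣ ℝ.≤ r ℝ.* s
  ∣*∣≤ {x} {y} ∣x∣≤r ∣y∣≤s = ℝ.≤-respˡ-≈ (ℝ.sym (∣∣-* x y))
    (ℝ.*-mono-≤ (∣∣-nonneg y) (ℝ.≤-trans (∣∣-nonneg x) ∣x∣≤r) ∣x∣≤r ∣y∣≤s)

  ∣sum∣≤ : ∀ {n} {f : Vector Carrier n} {r} → ℝ.0# ℝ.≤ r → (∀ i → ∣ f i ∣ ℝ.≤ r) → ∣ sum f ∣ ℝ.≤ r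
  ∣sum∣≤ {zero}  0≤r ∣f∣≤r = ℝ.≤-respˡ-≈ (ℝ.sym ∣0∣) 0≤r
  ∣sum∣≤ {suc n} 0≤r ∣f∣≤r = ∣+∣≤ (∣f∣≤r zero) (∣sum∣≤ 0≤r (∣f∣≤r ∘ suc))

  ∣sum∣< : ∀ {n} {f : Vector Carrier n} {r} → ℝ.0# ℝ.< r → (∀ i → ∣ f i ∣ ℝ.< r) → ∣ sum f ∣ ℝ.< r
  ∣sum∣< {zero}  0<r ∣f∣<r = ℝ.<-respˡ-≈ (ℝ.sym ∣0∣) 0<r
  ∣sum∣< {suc n} 0<r ∣f∣<r = ∣+∣< (∣f∣<r zero) (∣sum∣< 0<r (∣f∣<r ∘ suc))

  ∣fromℕ∣≤1 : ∀ n → ∣ fromℕ n ∣ ℝ.≤ ℝ.1#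
  ∣fromℕ∣≤1 zero    = ℝ.≤-respˡ-≈ (ℝ.sym ∣0∣) (ℝ.<⇒≤ ℝ.0<1)
  ∣fromℕ∣≤1 (suc n) = ∣+∣≤ (ℝ.≤-reflexive ∣1∣) (∣fromℕ∣≤1 n)

  -- If `|x|` were below `|y|`, then `y` would be a sum of `-(x - y)` and `x`, both smaller than
  -- `|y|`. The exact absolute values of pivots, eigenvalues and determinants are read off from
  -- this.
  isosceles : ∀ {x y} → ∣ x - y ∣ ℝ.< ∣ y ∣ → ∣ x ∣ ℝ.≈ ∣ y ∣
  isosceles {x} {y} ∣x-y∣<∣y∣ = ℝ.≤-antisym
    (ℝ.≤-respˡ-≈ (∣∣-cong (solve 2 (λ x y → (x :- y) :+ y := x) refl x y))
      (∣+∣≤ (ℝ.<⇒≤ ∣x-y∣<∣y∣) ℝ.≤-refl))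
    (ℝ.≮⇒≥ λ ∣x∣<∣y∣ → ℝ.<-irrefl
      (∣∣-cong (solve 2 (λ x y → :- (x :- y) :+ x := y) refl x y))
      (∣+∣< (ℝ.<-respˡ-≈ (ℝ.sym (∣-x∣ _)) ∣x-y∣<∣y∣) ∣x∣<∣y∣))

  -- For nonzero `x` the bound fails at half of `|x|`; since the hypothesis is a weak inequality,
  -- `|x|` itself would not refute it.
  ∣∣-infinitesimal : ∀ {x} → (∀ {ε} → ℝ.0# ℝ.< ε → ∣ x ∣ ℝ.≤ ε) → x ≈ 0#
  ∣∣-infinitesimal {x} small with em {P = x ≈ 0#}
  ... | yes x≈0 = x≈0
  ... | no  x≉0 = contradiction (small 0<y) (ℝ.<⇒≱ y<∣x∣)
    where
    open ℝ-Reasoning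
    1+1 : ℝ.Carrier
    1+1 = ℝ.1# ℝ.+ ℝ.1#
    1<1+1 : ℝ.1# ℝ.< 1+1
    1<1+1 = ℝ.<-respˡ-≈ (ℝ.+-identityʳ _) (ℝ.+-monoʳ-< ℝ.1# ℝ.0<1)
    0<1+1 : ℝ.0# ℝ.< 1+1
    0<1+1 = ℝ.<-trans ℝ.0<1 1<1+1
    y : ℝ.Carrier
    y = 1+1 ℝ.⁻¹ ℝ.* ∣ x ∣
    0<y : ℝ.0# ℝ.< y
    0<y = ℝ.*-positive (ℝ.⁻¹-positive 0<1+1) (∣∣-positive x≉0)
    y<∣x∣ : y ℝ.< ∣ x ∣
    y<∣x∣ = begin-strict
      y              ≈⟨ ℝ.*-identityˡ y ⟨
      ℝ.1# ℝ.* y     <⟨ ℝ.*-monoˡ-< 0<y 1<1+1 ⟩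
      1+1 ℝ.* y      ≈⟨ ℝ.*-assoc _ _ _ ⟨
      1+1 ℝ.* 1+1 ℝ.⁻¹ ℝ.* ∣ x ∣  ≈⟨ ℝ.*-congʳ (ℝ.⁻¹-inverseʳ (ℝ.<⇒≉ 0<1+1)) ⟩
      ℝ.1# ℝ.* ∣ x ∣  ≈⟨ ℝ.*-identityˡ _ ⟩
      ∣ x ∣          ∎

  sum-- : ∀ {n} (f g : Vector Carrier n) → sum f - sum g ≈ sum (λ i → f i - g i)
  sum-- f g = begin
    sum f - sum g                        ≈⟨ +-congˡ (-1*x≈-x _) ⟨
    sum f + - 1# * sum g                 ≈⟨ +-congˡ (*-distribˡ-sum (- 1#) g) ⟩
    sum f + sum (λ i → - 1# * g i)       ≈⟨ ∑-distrib-+ f (λ i → - 1# * g i) ⟨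
    sum (λ i → f i + - 1# * g i)         ≈⟨ sum-cong-≋ {x = λ i → f i + - 1# * g i} {y = λ i → f i - g i}
                                              (λ i → +-congˡ (-1*x≈-x (g i))) ⟩
    sum (λ i → f i - g i)                ∎
    where open K-Reasoning

  infix 8 _·ˢ_
  _·ˢ_ : ∀ {n} → Vector Carrier n → Vector Carrier n → Carrier
  u ·ˢ v = sum λ i → u i * v i

  ∣·ˢ∣≤ : ∀ {n} {u v : Vector Carrier n} {r s} → ℝ.0# ℝ.≤ r → ℝ.0# ℝ.≤ s →
          (∀ i → ∣ u i ∣ ℝ.≤ r) → (∀ i → ∣ v i ∣ ℝ.≤ s) → ∣ u ·ˢ v ∣ ℝ.≤ r ℝ.* s
  ∣·ˢ∣≤ 0≤r 0≤s ∣u∣≤r ∣v∣≤s = ∣sum∣≤ (ℝ.*-nonneg 0≤r 0≤s) λ i → ∣*∣≤ (∣u∣≤r i) (∣v∣≤s i)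

  ·ˢ--ˡ : ∀ {n} (u v w : Vector Carrier n) → u ·ˢ w - v ·ˢ w ≈ (λ i → u i - v i) ·ˢ w
  ·ˢ--ˡ u v w = trans (sum-- (λ i → u i * w i) (λ i → v i * w i))
    (sum-cong-≋ {x = λ i → u i * w i - v i * w i} {y = λ i → (u i - v i) * w i} λ i →
      solve 3 (λ u v w → u :* w :- v :* w := (u :- v) :* w) refl (u i) (v i) (w i))

  ·ˢ--ʳ : ∀ {n} (u v w : Vector Carrier n) → u ·ˢ v - u ·ˢ w ≈ u ·ˢ (λ i → v i - w i)
  ·ˢ--ʳ u v w = trans (sum-- (λ i → u i * v i) (λ i → u i * w i))
    (sum-cong-≋ {x = λ i → u i * v i - u i * w i} {y = λ i → u i * (v i - w i)} λ i →
      solve 3 (λ u v w → u :* v :- u :* w := u :* (v :- w)) refl (u i) (v i) (w i))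

  Ball : ∀ {n} → Vector Carrier n → ℝ.Carrier → Vector Carrier n → Set a
  Ball c r x = ∀ i → x i ∈ D (c i) r

  NearOne : ∀ {n} → ℝ.Carrier → Vector Carrier n → Set a
  NearOne = Ball (λ _ → 1#)

  nearOne⇒∣∣≤1 : ∀ {x r} → r ℝ.≤ ℝ.1# → x ∈ D 1# r → ∣ x ∣ ℝ.≤ ℝ.1#
  nearOne⇒∣∣≤1 {x} r≤1 ∣x-1∣≤r = ℝ.≤-respˡ-≈
    (∣∣-cong (solve 1 (λ x → (x :- con (+ 1)) :+ con (+ 1) := x) refl x))
    (∣+∣≤ (ℝ.≤-trans ∣x-1∣≤r r≤1) (ℝ.≤-reflexive ∣1∣))

  ∣nearOne-nearOne∣≤ : ∀ {x y r} → x ∈ D 1# r → y ∈ D 1# r → ∣ x - y ∣ ℝ.≤ r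
  ∣nearOne-nearOne∣≤ {x} {y} x∈D y∈D = ∣x-z∣≤ 1# x∈D (ℝ.≤-respˡ-≈ (∣x-y∣≈∣y-x∣ y 1#) y∈D)

  -- Since `u v - 1 = u (v - 1) + (u - 1)`, each product stays within `r` of 1, and the ultrametric
  -- sum adds no further error. Applied to pivots and to the pairing of the two eigenvectors.
  nearOne-·ˢ : ∀ {n} {u v : Vector Carrier n} {r} → ℝ.0# ℝ.≤ r → r ℝ.≤ ℝ.1# →
               NearOne r u → NearOne r v → u ·ˢ v ∈ D (fromℕ n) r
  nearOne-·ˢ {n} {u} {v} {r} 0≤r r≤1 u-near v-near = ℝ.≤-respˡ-≈ (∣∣-cong (begin
    sum (λ i → u i * v i - 1#)         ≈⟨ sum-- (λ i → u i * v i) (replicate n 1#) ⟨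
    u ·ˢ v - sum (replicate n 1#)      ≈⟨ +-congˡ (-‿cong (sum-replicate n)) ⟩
    u ·ˢ v - fromℕ n                   ∎))
    (∣sum∣≤ 0≤r λ i → ℝ.≤-respˡ-≈
      (∣∣-cong (solve 2 (λ u v → u :* (v :- con (+ 1)) :+ (u :- con (+ 1)) := u :* v :- con (+ 1))
        refl (u i) (v i)))
      (∣+∣≤ (ℝ.≤-respʳ-≈ (ℝ.*-identityˡ r) (∣*∣≤ (nearOne⇒∣∣≤1 r≤1 (u-near i)) (v-near i)))
            (u-near i)))
    where open K-Reasoning

  -- One late term with `|s k - x| < r` suffices: in an ultrametric the radius does not grow when
  -- the two estimates are combined.
  limit-within : ∀ {s x y r N} → ℝ.0# ℝ.< r → s ⟶ x → (∀ k → N ℕ.≤ k → ∣ s k - y ∣ ℝ.≤ r) →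
                 ∣ x - y ∣ ℝ.≤ r
  limit-within {s} {x} {y} {N = N} 0<r s⟶x ∣s-y∣≤r =
    ∣x-z∣≤ (s k) (ℝ.≤-respˡ-≈ (∣x-y∣≈∣y-x∣ (s k) x) (ℝ.<⇒≤ (proj₂ (s⟶x 0<r) k (ℕ.m≤n⊔m N _))))
      (∣s-y∣≤r k (ℕ.m≤m⊔n N _))
    where
    k : ℕ
    k = N ℕ.⊔ proj₁ (s⟶x 0<r)

  -- Banach's principle on a closed ball. The maximum norm appears only as an arbitrary common bound
  -- `s` of the coordinate differences.
  module FixedPoint (complete : IsComplete) {n} (c : Vector Carrier n) {r κ : ℝ.Carrier}
    (0<r : ℝ.0# ℝ.< r) (0<κ : ℝ.0# ℝ.< κ) (κ<1 : κ ℝ.< ℝ.1#)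
    (G : Vector Carrier n → Vector Carrier n)
    (G-ball : ∀ {x} → Ball c r x → Ball c r (G x))
    (G-contracts : ∀ {x y s} → Ball c r x → Ball c r y → (∀ i → ∣ x i - y i ∣ ℝ.≤ s) →
                   ∀ i → ∣ G x i - G y i ∣ ℝ.≤ κ ℝ.* s)
    where
    private
      orbit : ℕ → Vector Carrier n
      orbit zero    = c
      orbit (suc k) = G (orbit k)

      orbit-ball : ∀ k → Ball c r (orbit k)
      orbit-ball zero    i = ℝ.≤-respˡ-≈ (ℝ.sym (ℝ.trans (∣∣-cong (-‿inverseʳ (c i))) ∣0∣)) (ℝ.<⇒≤ 0<r)
      orbit-ball (suc k) = G-ball (orbit-ball k)

      shift : ∀ k → r ℝ.* κ ℝ.^ suc k ℝ.≈ κ ℝ.* (r ℝ.* κ ℝ.^ k)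
      shift k = ℝ.trans (ℝ.sym (ℝ.*-assoc _ _ _)) (ℝ.trans (ℝ.*-congʳ (ℝ.*-comm r κ)) (ℝ.*-assoc _ _ _))

      -- Induction on `k` and not on `d`: the orbit starts at the centre, so the ball bounds every
      -- difference at stage 0, and each application of `G` contributes a factor `κ`. This replaces
      -- the usual telescoping sum.
      orbit-step : ∀ k d i → ∣ orbit (d ℕ.+ k) i - orbit k i ∣ ℝ.≤ r ℝ.* κ ℝ.^ k
      orbit-step zero    d i = ℝ.≤-respʳ-≈ (ℝ.sym (ℝ.*-identityʳ r)) (orbit-ball (d ℕ.+ zero) i)
      orbit-step (suc k) d i rewrite ℕ.+-suc d k = ℝ.≤-respʳ-≈ (ℝ.sym (shift k))
        (G-contracts (orbit-ball (d ℕ.+ k)) (orbit-ball k) (orbit-step k d) i)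

      orbit-tail : ∀ k {j} → k ℕ.≤ j → ∀ i → ∣ orbit j i - orbit k i ∣ ℝ.≤ r ℝ.* κ ℝ.^ k
      orbit-tail k {j} k≤j i = ≡.subst (λ j → ∣ orbit j i - orbit k i ∣ ℝ.≤ r ℝ.* κ ℝ.^ k)
        (ℕ.m∸n+n≡m k≤j) (orbit-step k (j ℕ.∸ k) i)

      decay : ∀ {ε} → ℝ.0# ℝ.< ε → ∃ λ N → ∀ k → N ℕ.≤ k → r ℝ.* κ ℝ.^ k ℝ.< ε
      decay = ℝ.geometric-decay (ℝ.<⇒≤ 0<r) (ℝ.<⇒≤ 0<κ) κ<1

      orbit-cauchy : ∀ i → IsCauchy (λ k → orbit k i)
      orbit-cauchy i 0<ε with N , small ← decay 0<ε = N , λ j k N≤j N≤k → ℝ.≤-<-trans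
        (∣x-z∣≤ (orbit N i) (orbit-tail N N≤j i)
          (ℝ.≤-respˡ-≈ (∣x-y∣≈∣y-x∣ (orbit k i) (orbit N i)) (orbit-tail N N≤k i)))
        (small N ℕ.≤-refl)

      module Limit (x : Vector Carrier n) (orbit⟶x : ∀ i → (λ k → orbit k i) ⟶ x i) where
        near : ∀ k i → ∣ x i - orbit k i ∣ ℝ.≤ r ℝ.* κ ℝ.^ k
        near k i = limit-within {s = λ k → orbit k i} (ℝ.*-positive 0<r (ℝ.^-positive 0<κ k))
          (orbit⟶x i) (λ j k≤j → orbit-tail k k≤j i)

        ball : Ball c r x
        ball i = ℝ.≤-respʳ-≈ (ℝ.*-identityʳ r) (near zero i)

        nearlyFixed : ∀ k i → ∣ G x i - x i ∣ ℝ.≤ r ℝ.* κ ℝ.^ suc k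
        nearlyFixed k i = ∣x-z∣≤ (orbit (suc k) i)
          (ℝ.≤-respʳ-≈ (ℝ.sym (shift k)) (G-contracts ball (orbit-ball k) (near k) i))
          (ℝ.≤-respˡ-≈ (∣x-y∣≈∣y-x∣ (x i) (orbit (suc k) i)) (near (suc k) i))

        fixed : G x ≈ᵛ x
        fixed i = x∙y⁻¹≈ε⇒x≈y (G x i) (x i) (∣∣-infinitesimal λ {ε} 0<ε →
          let N , r*κ^k<ε = decay 0<ε
          -- The exponent in `nearlyFixed N` is `suc N`, so the decay is used one index past its
          -- threshold.
          in ℝ.≤-trans (nearlyFixed N i) (ℝ.<⇒≤ (r*κ^k<ε (suc N) (ℕ.n≤1+n N))))

    fixedPoint : ∃ λ x → Ball c r x × G x ≈ᵛ x
    fixedPoint = x , ball , fixed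
      where
      x : Vector Carrier n
      x i = proj₁ (complete (λ k → orbit k i) (orbit-cauchy i))
      open Limit x (λ i → proj₂ (complete (λ k → orbit k i) (orbit-cauchy i)))

-- Pairings, left eigenvectors and their hyperplanes

module DominantEigenvalue {a} (em : ExcludedMiddle a) {ℝ : Reals a}
  (K : NonArchimedeanField ℝ) where
  open NonArchimedeanField K hiding (zero)
  open FieldProperties em baseField
  open Inverse em baseField using (_⁻¹)
  open NonArchimedeanProperties em K
  open Sum (CommutativeRing.semiring commutativeRing) using
    (sum; sum-cong-≋; *-distribˡ-sum; *-distribʳ-sum; ∑-comm)
  open RingProperties (CommutativeRing.ring commutativeRing) using (-0#≈0#; x∙y⁻¹≈ε⇒x≈y)
  open IntegerSolver commutativeRing

  private
    module ℝ = RealArithmetic em ℝ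

  ·ˢ-scaleʳ : ∀ {n} (u v : Vector Carrier n) c → u ·ˢ (λ i → v i * c) ≈ (u ·ˢ v) * c
  ·ˢ-scaleʳ u v c = trans
    (sum-cong-≋ {x = λ i → u i * (v i * c)} {y = λ i → (u i * v i) * c}
      λ i → sym (*-assoc (u i) (v i) c))
    (sym (*-distribʳ-sum c (λ i → u i * v i)))

  ·ˢ-scaleˡ : ∀ {n} c (u v : Vector Carrier n) → (λ i → c * u i) ·ˢ v ≈ c * (u ·ˢ v)
  ·ˢ-scaleˡ c u v = trans
    (sum-cong-≋ {x = λ i → (c * u i) * v i} {y = λ i → c * (u i * v i)}
      λ i → *-assoc c (u i) (v i))
    (sym (*-distribˡ-sum c (λ i → u i * v i)))

  ·ˢ-congˡ : ∀ {n} {u v : Vector Carrier n} (w : Vector Carrier n) → u ≈ᵛ v → u ·ˢ w ≈ v ·ˢ w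
  ·ˢ-congˡ {u = u} {v} w u≈v =
    sum-cong-≋ {x = λ i → u i * w i} {y = λ i → v i * w i} λ i → *-congʳ (u≈v i)

  ·ˢ-congʳ : ∀ {n} (u : Vector Carrier n) {v w : Vector Carrier n} → v ≈ᵛ w → u ·ˢ v ≈ u ·ˢ w
  ·ˢ-congʳ u {v} {w} v≈w =
    sum-cong-≋ {x = λ i → u i * v i} {y = λ i → u i * w i} λ i → *-congˡ (v≈w i)

  private
    ·ˢ-zeroʳ : ∀ {n} (u : Vector Carrier n) → u ·ˢ (λ _ → 0#) ≈ 0#
    ·ˢ-zeroʳ {zero}  u = refl
    ·ˢ-zeroʳ {suc n} u = trans (+-cong (zeroʳ _) (·ˢ-zeroʳ (u ∘ suc))) (+-identityˡ _)

  ·ˢ-1ᴹ : ∀ {n} (u : Vector Carrier n) j → u ·ˢ (λ i → 1ᴹ i j) ≈ u j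
  ·ˢ-1ᴹ {suc n} u zero    = trans (+-cong (*-identityʳ (u zero)) (·ˢ-zeroʳ (u ∘ suc))) (+-identityʳ _)
  ·ˢ-1ᴹ {suc n} u (suc j) = trans (+-cong (zeroʳ (u zero)) (·ˢ-1ᴹ (u ∘ suc) j)) (+-identityˡ _)

  1ᴹ-symmetric : ∀ {n} (i j : Fin n) → 1ᴹ i j ≈ 1ᴹ j i
  1ᴹ-symmetric zero    zero    = refl
  1ᴹ-symmetric zero    (suc j) = refl
  1ᴹ-symmetric (suc i) zero    = refl
  1ᴹ-symmetric (suc i) (suc j) = 1ᴹ-symmetric i j

  1ᴹ-·ˢ : ∀ {n} (v : Vector Carrier n) i → 1ᴹ i ·ˢ v ≈ v i
  1ᴹ-·ˢ v i = trans
    (sum-cong-≋ {x = λ j → 1ᴹ i j * v j} {y = λ j → v j * 1ᴹ j i}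
      λ j → trans (*-comm _ _) (*-congˡ (1ᴹ-symmetric i j)))
    (·ˢ-1ᴹ v i)

  ∣1ᴹ∣≤1 : ∀ {n} (i j : Fin n) → ∣ 1ᴹ i j ∣ ℝ.≤ ℝ.1#
  ∣1ᴹ∣≤1 zero    zero    = ℝ.≤-reflexive ∣1∣
  ∣1ᴹ∣≤1 zero    (suc j) = ℝ.≤-respˡ-≈ (ℝ.sym ∣0∣) (ℝ.<⇒≤ ℝ.0<1)
  ∣1ᴹ∣≤1 (suc i) zero    = ℝ.≤-respˡ-≈ (ℝ.sym ∣0∣) (ℝ.<⇒≤ ℝ.0<1)
  ∣1ᴹ∣≤1 (suc i) (suc j) = ∣1ᴹ∣≤1 i j

  ·ˢ-*ᵛ : ∀ {n} (A : Matrix n) (u v : Vector Carrier n) →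
          u ·ˢ (A *ᵛ v) ≈ (transpose A *ᵛ u) ·ˢ v
  ·ˢ-*ᵛ A u v = begin
    sum (λ i → u i * sum (λ j → A i j * v j))
      ≈⟨ sum-cong-≋ {x = λ i → u i * sum (λ j → A i j * v j)} {y = λ i → sum (λ j → u i * (A i j * v j))}
           (λ i → *-distribˡ-sum (u i) (λ j → A i j * v j)) ⟩
    sum (λ i → sum (λ j → u i * (A i j * v j)))
      ≈⟨ ∑-comm (λ i j → u i * (A i j * v j)) ⟩
    sum (λ j → sum (λ i → u i * (A i j * v j)))
      ≈⟨ sum-cong-≋ {x = λ j → sum (λ i → u i * (A i j * v j))} {y = λ j → sum (λ i → A i j * u i) * v j}
           (λ j → trans
             (sum-cong-≋ {x = λ i → u i * (A i j * v j)} {y = λ i → A i j * u i * v j}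
               (λ i → rotate (u i) (A i j) (v j)))
             (sym (*-distribʳ-sum (v j) (λ i → A i j * u i)))) ⟩
    sum (λ j → sum (λ i → A i j * u i) * v j) ∎
    where
    open K-Reasoning
    rotate : ∀ x y z → x * (y * z) ≈ y * x * z
    rotate = solve 3 (λ x y z → x :* (y :* z) := y :* x :* z) refl

  leftEigenvector-·ˢ : ∀ {n} {A : Matrix n} {μ w} → (transpose A *ᵛ w) ≈ᵛ (μ ·ᵛ w) →
                       ∀ v → w ·ˢ (A *ᵛ v) ≈ μ * (w ·ˢ v)
  leftEigenvector-·ˢ {A = A} {μ} {w} wA≈μw v =
    trans (·ˢ-*ᵛ A w v) (trans (·ˢ-congˡ v wA≈μw) (·ˢ-scaleˡ μ w v))

  -- Computing `w · A v` from either side gives `(z - μ) (w · v) = 0`. This places every other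
  -- eigenvector in the hyperplane on which `A` is small.
  leftEigenvector-⊥ : ∀ {n} {A : Matrix n} {μ z w v} → (transpose A *ᵛ w) ≈ᵛ (μ ·ᵛ w) →
                      (A *ᵛ v) ≈ᵛ (z ·ᵛ v) → z ≉ μ → w ·ˢ v ≈ 0#
  leftEigenvector-⊥ {A = A} {μ} {z} {w} {v} wA≈μw Av≈zv z≉μ =
    *-zero-product (z≉μ ∘ x∙y⁻¹≈ε⇒x≈y z μ) (begin
      (z - μ) * (w ·ˢ v)              ≈⟨ expand z μ (w ·ˢ v) ⟩
      (w ·ˢ v) * z - μ * (w ·ˢ v)     ≈⟨ +-congʳ (·ˢ-scaleʳ w v z) ⟨
      w ·ˢ (λ i → v i * z) - μ * (w ·ˢ v)
        ≈⟨ +-congʳ (·ˢ-congʳ w (λ i → trans (*-comm (v i) z) (sym (Av≈zv i)))) ⟩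
      w ·ˢ (A *ᵛ v) - μ * (w ·ˢ v)    ≈⟨ +-congʳ (leftEigenvector-·ˢ wA≈μw v) ⟩
      μ * (w ·ˢ v) - μ * (w ·ˢ v)     ≈⟨ -‿inverseʳ _ ⟩
      0#                              ∎)
    where
    open K-Reasoning
    expand : ∀ z μ c → (z - μ) * c ≈ c * z - μ * c
    expand = solve 3 (λ z μ c → (z :- μ) :* c := c :* z :- μ :* c) refl

  -- On the hyperplane w · v = 0, the matrix A acts like A - 1 wᵀ.
  ∣*ᵛ∣≤-⊥ : ∀ {n} {A : Matrix n} {w v : Vector Carrier n} {ρ r} → ℝ.0# ℝ.≤ ρ → ℝ.0# ℝ.≤ r →
            (∀ i j → ∣ A i j - w j ∣ ℝ.≤ ρ) → w ·ˢ v ≈ 0# → (∀ j → ∣ v j ∣ ℝ.≤ r) →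
            ∀ i → ∣ (A *ᵛ v) i ∣ ℝ.≤ ρ ℝ.* r
  ∣*ᵛ∣≤-⊥ {A = A} {w} {v} 0≤ρ 0≤r ∣A-w∣≤ρ w⊥v ∣v∣≤r i = ℝ.≤-respˡ-≈ (∣∣-cong (begin
    (λ j → A i j - w j) ·ˢ v     ≈⟨ ·ˢ--ˡ (A i) w v ⟨
    A i ·ˢ v - w ·ˢ v            ≈⟨ +-congˡ (trans (-‿cong w⊥v) -0#≈0#) ⟩
    A i ·ˢ v + 0#                ≈⟨ +-identityʳ _ ⟩
    A i ·ˢ v                     ∎))
    (∣·ˢ∣≤ 0≤ρ 0≤r (∣A-w∣≤ρ i) ∣v∣≤r)
    where open K-Reasoning

  largestEntry : ∀ {n} (v : Vector Carrier (suc n)) → ∃ λ i → ∀ j → ∣ v j ∣ ℝ.≤ ∣ v i ∣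
  largestEntry {zero}  v = zero , λ where zero → ℝ.≤-refl
  largestEntry {suc n} v with i , ∣v∣≤∣vᵢ∣ ← largestEntry (v ∘ suc) | ℝ.≤-total ∣ v zero ∣ ∣ v (suc i) ∣
  ... | inj₁ ∣v₀∣≤∣vᵢ∣ = suc i , λ where
    zero    → ∣v₀∣≤∣vᵢ∣
    (suc j) → ∣v∣≤∣vᵢ∣ j
  ... | inj₂ ∣vᵢ∣≤∣v₀∣ = zero , λ where
    zero    → ℝ.≤-refl
    (suc j) → ℝ.≤-trans (∣v∣≤∣vᵢ∣ j) ∣vᵢ∣≤∣v₀∣

  -- The eigenvalue equation is read at an entry of largest absolute value, which is nonzero and
  -- hence may be cancelled.
  ∣eigenvalue∣≤-⊥ : ∀ {n} {A : Matrix (suc n)} {z w v ρ} → ℝ.0# ℝ.≤ ρ →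
                    (∀ i j → ∣ A i j - w j ∣ ℝ.≤ ρ) → w ·ˢ v ≈ 0# → IsEigenvector A z v →
                    ∣ z ∣ ℝ.≤ ρ
  ∣eigenvalue∣≤-⊥ {A = A} {z} {w} {v} {ρ} 0≤ρ ∣A-w∣≤ρ w⊥v (v≉0 , Av≈zv)
    with i , ∣v∣≤∣vᵢ∣ ← largestEntry v = ℝ.*-cancelˡ-≤ (∣∣-positive vᵢ≉0) (begin
      ∣ v i ∣ ℝ.* ∣ z ∣    ≈⟨ ℝ.*-comm _ _ ⟩
      ∣ z ∣ ℝ.* ∣ v i ∣    ≈⟨ ∣∣-* z (v i) ⟨
      ∣ z * v i ∣          ≈⟨ ∣∣-cong (Av≈zv i) ⟨
      ∣ (A *ᵛ v) i ∣       ≤⟨ ∣*ᵛ∣≤-⊥ 0≤ρ (∣∣-nonneg (v i)) ∣A-w∣≤ρ w⊥v ∣v∣≤∣vᵢ∣ i ⟩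
      ρ ℝ.* ∣ v i ∣        ≈⟨ ℝ.*-comm _ _ ⟩
      ∣ v i ∣ ℝ.* ρ        ∎)
    where
    open ℝ-Reasoning
    vᵢ≉0 : v i ≉ 0#
    vᵢ≉0 vᵢ≈0 = v≉0 λ j → ∣∣-definite (ℝ.≤-antisym
      (ℝ.≤-respʳ-≈ (ℝ.trans (∣∣-cong vᵢ≈0) ∣0∣) (∣v∣≤∣vᵢ∣ j)) (∣∣-nonneg (v j)))

  ∣otherEigenvalue∣≤ : ∀ {n} {A : Matrix (suc n)} {μ z w ρ} → ℝ.0# ℝ.≤ ρ →
                       (∀ i j → ∣ A i j - w j ∣ ℝ.≤ ρ) → (transpose A *ᵛ w) ≈ᵛ (μ ·ᵛ w) →
                       IsEigenvalue A z → z ≉ μ → ∣ z ∣ ℝ.≤ ρ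
  ∣otherEigenvalue∣≤ {A = A} {w = w} 0≤ρ ∣A-w∣≤ρ wA≈μw (v , v≉0 , Av≈zv) z≉μ =
    ∣eigenvalue∣≤-⊥ {A = A} 0≤ρ ∣A-w∣≤ρ (leftEigenvector-⊥ {A = A} {w = w} wA≈μw Av≈zv z≉μ) (v≉0 , Av≈zv)

  -- Matrices close to the all-ones matrix

  module NearAllOnes (complete : IsComplete) (m : ℕ) {ε : ℝ.Carrier} (0<ε : ℝ.0# ℝ.< ε)
    (ε<ν² : ε ℝ.< ∣ fromℕ (suc m) ∣ ℝ.* ∣ fromℕ (suc m) ∣) where

    private
      n : ℕ
      n = suc m

    -- Here `ε` stands for `|π|^ℓ`. The radius of the discs in (b) and (c) is `ρ`, while `κ` is both
    -- the contraction factor of the iteration and the rate of convergence in (d).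
    ν ρ κ : ℝ.Carrier
    ν = ∣ fromℕ n ∣
    ρ = ε ℝ./ ν
    κ = ρ ℝ./ ν

    -- This is where `n` is seen to be nonzero in `K`: otherwise `ε` would be positive and below
    -- `ν² = 0`.
    0<ν : ℝ.0# ℝ.< ν
    0<ν = ℝ.≤∧≉⇒< (∣∣-nonneg _) λ ν≈0 →
      ℝ.<-irrefl ℝ.refl (ℝ.<-trans 0<ε (ℝ.<-respʳ-≈ (ℝ.trans (ℝ.*-congʳ ν≈0) (ℝ.zeroˡ ν)) ε<ν²))

    private
      0<ν⁻¹ : ℝ.0# ℝ.< ν ℝ.⁻¹
      0<ν⁻¹ = ℝ.⁻¹-positive 0<ν

      ν≤1 : ν ℝ.≤ ℝ.1#
      ν≤1 = ∣fromℕ∣≤1 n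

      cancel-ν : ∀ x → x ℝ.* ν ℝ.* ν ℝ.⁻¹ ℝ.≈ x
      cancel-ν x = ℝ.trans (ℝ.*-assoc _ _ _)
        (ℝ.trans (ℝ.*-congˡ (ℝ.⁻¹-inverseʳ (ℝ.<⇒≉ 0<ν))) (ℝ.*-identityʳ x))

      1≤ν⁻¹ : ℝ.1# ℝ.≤ ν ℝ.⁻¹
      1≤ν⁻¹ = begin
        ℝ.1#                    ≈⟨ ℝ.⁻¹-inverseʳ (ℝ.<⇒≉ 0<ν) ⟨
        ν ℝ.* ν ℝ.⁻¹            ≤⟨ ℝ.*-monoˡ-≤ (ℝ.<⇒≤ 0<ν⁻¹) ν≤1 ⟩
        ℝ.1# ℝ.* ν ℝ.⁻¹         ≈⟨ ℝ.*-identityˡ _ ⟩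
        ν ℝ.⁻¹                  ∎
        where open ℝ-Reasoning

    0<ρ : ℝ.0# ℝ.< ρ
    0<ρ = ℝ.*-positive 0<ε 0<ν⁻¹

    ρ<ν : ρ ℝ.< ν
    ρ<ν = ℝ.<-respʳ-≈ (cancel-ν ν) (ℝ.*-monoˡ-< 0<ν⁻¹ ε<ν²)

    ρ≤1 : ρ ℝ.≤ ℝ.1#
    ρ≤1 = ℝ.≤-trans (ℝ.<⇒≤ ρ<ν) ν≤1

    ε≤ρ : ε ℝ.≤ ρ
    ε≤ρ = ℝ.≤-respˡ-≈ (ℝ.*-identityʳ ε) (ℝ.*-monoʳ-≤ (ℝ.<⇒≤ 0<ε) 1≤ν⁻¹)

    private
      0<κ : ℝ.0# ℝ.< κ
      0<κ = ℝ.*-positive 0<ρ 0<ν⁻¹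

      κ<1 : κ ℝ.< ℝ.1#
      κ<1 = ℝ.<-respʳ-≈ (ℝ.⁻¹-inverseʳ (ℝ.<⇒≉ 0<ν)) (ℝ.*-monoˡ-< 0<ν⁻¹ ρ<ν)

    ∣near-n∣ : ∀ {x} → x ∈ D (fromℕ n) ρ → ∣ x ∣ ℝ.≈ ν
    ∣near-n∣ x∈D = isosceles (ℝ.≤-<-trans x∈D ρ<ν)

    ≉0 : ∀ {x} → ∣ x ∣ ℝ.≈ ν → x ≉ 0#
    ≉0 ∣x∣≈ν = ∣∣-positive⁻¹ (ℝ.<-respʳ-≈ (ℝ.sym ∣x∣≈ν) 0<ν)

    ∣inverse∣ : ∀ {x} → ∣ x ∣ ℝ.≈ ν → ∣ x ⁻¹ ∣ ℝ.≈ ν ℝ.⁻¹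
    ∣inverse∣ {x} ∣x∣≈ν = ℝ.*-cancelˡ (ℝ.<⇒≉ 0<ν) (begin-equality
      ν ℝ.* ∣ x ⁻¹ ∣          ≈⟨ ℝ.*-congʳ ∣x∣≈ν ⟨
      ∣ x ∣ ℝ.* ∣ x ⁻¹ ∣      ≈⟨ ∣∣-* x (x ⁻¹) ⟨
      ∣ x * x ⁻¹ ∣            ≈⟨ ∣∣-cong (⁻¹-inverseʳ (≉0 ∣x∣≈ν)) ⟩
      ∣ 1# ∣                  ≈⟨ ∣1∣ ⟩
      ℝ.1#                    ≈⟨ ℝ.⁻¹-inverseʳ (ℝ.<⇒≉ 0<ν) ⟨
      ν ℝ.* ν ℝ.⁻¹            ∎)
      where open ℝ-Reasoning

    -- An eigenvector by normalized power iteration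

    module PowerIteration (A : Matrix n) (A-near : ∀ i → NearOne ε (A i)) where
      private
        pivot : Vector Carrier n → Carrier
        pivot x = (A *ᵛ x) zero

        normalize : Vector Carrier n → Vector Carrier n
        normalize x i = (A *ᵛ x) i * pivot x ⁻¹

        pivot-near : ∀ {x} → NearOne ρ x → pivot x ∈ D (fromℕ n) ρ
        pivot-near x-near = nearOne-·ˢ (ℝ.<⇒≤ 0<ρ) ρ≤1 (λ j → ℝ.≤-trans (A-near zero j) ε≤ρ) x-near

        ∣pivot∣ : ∀ {x} → NearOne ρ x → ∣ pivot x ∣ ℝ.≈ ν
        ∣pivot∣ x-near = ∣near-n∣ (pivot-near x-near)

        -- For `x` near the all-ones vector, `(A *ᵛ x) i` has size `ν`, but the rows of `A` agree up
        -- to `ε`, so subtracting the pivot leaves only size `ε`. All estimates on `normalize` go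
        -- through this difference.
        gap : Fin n → Vector Carrier n → Carrier
        gap i x = (A *ᵛ x) i - pivot x

        rowGap : ∀ i j → ∣ A i j - A zero j ∣ ℝ.≤ ε
        rowGap i j = ∣nearOne-nearOne∣≤ (A-near i j) (A-near zero j)

        ∣gap∣≤ : ∀ {x} i → (∀ j → ∣ x j ∣ ℝ.≤ ℝ.1#) → ∣ gap i x ∣ ℝ.≤ ε
        ∣gap∣≤ {x} i ∣x∣≤1 = ℝ.≤-respˡ-≈ (∣∣-cong (sym (·ˢ--ˡ (A i) (A zero) x)))
          (ℝ.≤-respʳ-≈ (ℝ.*-identityʳ ε)
            (∣·ˢ∣≤ (ℝ.<⇒≤ 0<ε) (ℝ.<⇒≤ ℝ.0<1) (rowGap i) ∣x∣≤1))

        normalize-1 : ∀ {x} i → NearOne ρ x → normalize x i - 1# ≈ gap i x * pivot x ⁻¹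
        normalize-1 {x} i x-near = trans
          (+-congˡ (-‿cong (sym (⁻¹-inverseʳ (≉0 (∣pivot∣ x-near))))))
          (factor ((A *ᵛ x) i) (pivot x) (pivot x ⁻¹))
          where
          factor : ∀ u v w → u * w - v * w ≈ (u - v) * w
          factor = solve 3 (λ u v w → u :* w :- v :* w := (u :- v) :* w) refl

        normalize-ball : ∀ {x} → NearOne ρ x → NearOne ρ (normalize x)
        normalize-ball {x} x-near i = ℝ.≤-respˡ-≈ (∣∣-cong (sym (normalize-1 i x-near)))
          (∣*∣≤ (∣gap∣≤ {x} i λ j → nearOne⇒∣∣≤1 ρ≤1 (x-near j))
                (ℝ.≤-reflexive (∣inverse∣ (∣pivot∣ x-near))))

        -- The difference `u/X - v/Y` over the common denominator. The numerator is split so that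
        -- each summand, with gaps for `u` and `v` and pivots for `X` and `Y`, carries both a factor
        -- `ε` from the rows and a factor `s` from the difference of the vectors.
        cross : ∀ u v {X X′ Y Y′} → X * X′ ≈ 1# → Y * Y′ ≈ 1# →
                ((u - v) * Y + v * (Y - X)) * X′ * Y′ ≈ u * X′ - v * Y′
        cross u v {X} {X′} {Y} {Y′} XX′≈1 YY′≈1 = begin
          ((u - v) * Y + v * (Y - X)) * X′ * Y′
            ≈⟨ solve 6 (λ u v X X′ Y Y′ → ((u :- v) :* Y :+ v :* (Y :- X)) :* X′ :* Y′ :=
                                          u :* X′ :* (Y :* Y′) :- v :* Y′ :* (X :* X′))
                 refl u v X X′ Y Y′ ⟩
          u * X′ * (Y * Y′) - v * Y′ * (X * X′)
            ≈⟨ +-cong (trans (*-congˡ YY′≈1) (*-identityʳ _))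
                      (-‿cong (trans (*-congˡ XX′≈1) (*-identityʳ _))) ⟩
          u * X′ - v * Y′ ∎
          where open K-Reasoning

        ∣A*ᵛx-A*ᵛy∣≤ : ∀ {x y s} i → ℝ.0# ℝ.≤ s → (∀ j → ∣ x j - y j ∣ ℝ.≤ s) →
                       ∣ (A *ᵛ x) i - (A *ᵛ y) i ∣ ℝ.≤ s
        ∣A*ᵛx-A*ᵛy∣≤ {x} {y} i 0≤s ∣x-y∣≤s = ℝ.≤-respˡ-≈ (∣∣-cong (sym (·ˢ--ʳ (A i) x y)))
          (ℝ.≤-respʳ-≈ (ℝ.*-identityˡ _) (∣·ˢ∣≤ (ℝ.<⇒≤ ℝ.0<1) 0≤s
            (λ j → nearOne⇒∣∣≤1 (ℝ.≤-trans ε≤ρ ρ≤1) (A-near i j)) ∣x-y∣≤s))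

        ∣gap-gap∣≤ : ∀ {x y s} i → ℝ.0# ℝ.≤ s → (∀ j → ∣ x j - y j ∣ ℝ.≤ s) →
                     ∣ gap i x - gap i y ∣ ℝ.≤ ε ℝ.* s
        ∣gap-gap∣≤ {x} {y} i 0≤s ∣x-y∣≤s = ℝ.≤-respˡ-≈
          (∣∣-cong (sym (trans (+-cong (·ˢ--ˡ (A i) (A zero) x) (-‿cong (·ˢ--ˡ (A i) (A zero) y)))
                               (·ˢ--ʳ (λ j → A i j - A zero j) x y))))
          (∣·ˢ∣≤ (ℝ.<⇒≤ 0<ε) 0≤s (rowGap i) ∣x-y∣≤s)

        normalize-contracts : ∀ {x y s} → NearOne ρ x → NearOne ρ y → (∀ i → ∣ x i - y i ∣ ℝ.≤ s) →
                              ∀ i → ∣ normalize x i - normalize y i ∣ ℝ.≤ κ ℝ.* s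
        normalize-contracts {x} {y} {s} x-near y-near ∣x-y∣≤s i =
          ℝ.≤-respʳ-≈ (regroup ε s (ν ℝ.⁻¹)) (ℝ.≤-respˡ-≈ (∣∣-cong (begin
            (((gap i x - gap i y) * pivot y + gap i y * (pivot y - pivot x)) * pivot x ⁻¹) * pivot y ⁻¹
              ≈⟨ cross (gap i x) (gap i y) (⁻¹-inverseʳ (≉0 (∣pivot∣ x-near)))
                                           (⁻¹-inverseʳ (≉0 (∣pivot∣ y-near))) ⟩
            gap i x * pivot x ⁻¹ - gap i y * pivot y ⁻¹
              ≈⟨ +-cong (normalize-1 i x-near) (-‿cong (normalize-1 i y-near)) ⟨
            (normalize x i - 1#) - (normalize y i - 1#)
              ≈⟨ drop-1 (normalize x i) (normalize y i) ⟩
            normalize x i - normalize y i ∎))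
            (∣*∣≤ (∣*∣≤ (∣+∣≤
                -- The factor `pivot y` is bounded by 1 here, which gives both summands the same
                -- bound `ε s`.
                (ℝ.≤-respʳ-≈ (ℝ.*-identityʳ _) (∣*∣≤ (∣gap-gap∣≤ i 0≤s ∣x-y∣≤s)
                  (ℝ.≤-trans (ℝ.≤-reflexive (∣pivot∣ y-near)) ν≤1)))
                (∣*∣≤ (∣gap∣≤ {y} i λ j → nearOne⇒∣∣≤1 ρ≤1 (y-near j))
                      (∣A*ᵛx-A*ᵛy∣≤ {y} {x} zero 0≤s λ j → ℝ.≤-respˡ-≈ (∣x-y∣≈∣y-x∣ (x j) (y j)) (∣x-y∣≤s j))))
              (ℝ.≤-reflexive (∣inverse∣ (∣pivot∣ x-near))))
              (ℝ.≤-reflexive (∣inverse∣ (∣pivot∣ y-near)))))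
          where
          open K-Reasoning
          0≤s : ℝ.0# ℝ.≤ s
          0≤s = ℝ.≤-trans (∣∣-nonneg _) (∣x-y∣≤s i)
          drop-1 : ∀ u v → (u - 1#) - (v - 1#) ≈ u - v
          drop-1 = solve 2 (λ u v → (u :- con (+ 1)) :- (v :- con (+ 1)) := u :- v) refl
          regroup : ∀ e s i → ((e ℝ.* s) ℝ.* i) ℝ.* i ℝ.≈ (e ℝ.* i) ℝ.* i ℝ.* s
          regroup = ℝS.solve 3 (λ e s i → ((e ℝS.:* s) ℝS.:* i) ℝS.:* i ℝS.:= (e ℝS.:* i) ℝS.:* i ℝS.:* s) ℝ.refl
            where module ℝS = IntegerSolver ℝ.commutativeRing

      -- At a fixed point the pivot is the eigenvalue. The normalization `x zero ≈ 1#` is recorded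
      -- because the deflation of the characteristic polynomial relies on it.
      eigenvector : ∃ λ μ → ∃ λ x → NearOne ρ x × x zero ≈ 1# × (A *ᵛ x) ≈ᵛ (μ ·ᵛ x) × μ ∈ D (fromℕ n) ρ
      eigenvector = fromFixedPoint (FixedPoint.fixedPoint complete (λ _ → 1#) 0<ρ 0<κ κ<1
        normalize normalize-ball normalize-contracts)
        where
        fromFixedPoint : (∃ λ x → NearOne ρ x × normalize x ≈ᵛ x) →
          ∃ λ μ → ∃ λ x → NearOne ρ x × x zero ≈ 1# × (A *ᵛ x) ≈ᵛ (μ ·ᵛ x) × μ ∈ D (fromℕ n) ρ
        fromFixedPoint (x , x-near , fixed) =
          pivot x , x , x-near , trans (sym (fixed zero)) (⁻¹-inverseʳ pivot≉0) , Ax≈μx , pivot-near x-near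
          where
          open K-Reasoning
          pivot≉0 : pivot x ≉ 0#
          pivot≉0 = ≉0 (∣pivot∣ x-near)
          Ax≈μx : (A *ᵛ x) ≈ᵛ (pivot x ·ᵛ x)
          Ax≈μx i = begin
            (A *ᵛ x) i                              ≈⟨ *-identityʳ _ ⟨
            (A *ᵛ x) i * 1#                         ≈⟨ *-congˡ (⁻¹-inverseˡ pivot≉0) ⟨
            (A *ᵛ x) i * (pivot x ⁻¹ * pivot x)     ≈⟨ *-assoc _ _ _ ⟨
            normalize x i * pivot x                 ≈⟨ *-congʳ (fixed i) ⟩
            x i * pivot x                           ≈⟨ *-comm _ _ ⟩
            pivot x * x i                           ∎

    -- The spectral projection and the limit of the powers

    module Projection {A : Matrix n} {μ μ′ : Carrier} {x w : Vector Carrier n}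
      (A-near : ∀ i → NearOne ε (A i)) (μ-near : μ ∈ D (fromℕ n) ρ)
      (x-near : NearOne ρ x) (Ax≈μx : (A *ᵛ x) ≈ᵛ (μ ·ᵛ x))
      (w-near : NearOne ρ w) (wA≈μ′w : (transpose A *ᵛ w) ≈ᵛ (μ′ ·ᵛ w)) where

      private
        σ s : Carrier
        σ = w ·ˢ x
        s = σ ⁻¹

        ∣σ∣≈ν : ∣ σ ∣ ℝ.≈ ν
        ∣σ∣≈ν = ∣near-n∣ (nearOne-·ˢ (ℝ.<⇒≤ 0<ρ) ρ≤1 w-near x-near)

        σs≈1 : σ * s ≈ 1#
        σs≈1 = ⁻¹-inverseʳ (≉0 ∣σ∣≈ν)

        ∣μ∣≈ν : ∣ μ ∣ ℝ.≈ ν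
        ∣μ∣≈ν = ∣near-n∣ μ-near

        μ≉0 : μ ≉ 0#
        μ≉0 = ≉0 ∣μ∣≈ν

        ∣x∣≤1 : ∀ i → ∣ x i ∣ ℝ.≤ ℝ.1#
        ∣x∣≤1 i = nearOne⇒∣∣≤1 ρ≤1 (x-near i)

        ∣w∣≤1 : ∀ i → ∣ w i ∣ ℝ.≤ ℝ.1#
        ∣w∣≤1 i = nearOne⇒∣∣≤1 ρ≤1 (w-near i)

      ∣A-w∣≤ρ : ∀ i j → ∣ A i j - w j ∣ ℝ.≤ ρ
      ∣A-w∣≤ρ i j = ∣nearOne-nearOne∣≤ (ℝ.≤-trans (A-near i j) ε≤ρ) (w-near j)

      -- The vectors `x` and `w` come from separate fixed points, so their eigenvalues do not agree
      -- by construction. If they differed, `w · x` would vanish, against `|w · x| = ν`.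
      μ′≈μ : μ′ ≈ μ
      μ′≈μ with em {P = μ ≈ μ′}
      ... | yes μ≈μ′ = sym μ≈μ′
      ... | no  μ≉μ′ = contradiction (leftEigenvector-⊥ {A = A} wA≈μ′w Ax≈μx μ≉μ′) (≉0 ∣σ∣≈ν)

      P : Matrix n
      P i j = x i * (w j * s)

      private
        P*ᵛ : ∀ v i → (P *ᵛ v) i ≈ x i * (s * (w ·ˢ v))
        P*ᵛ v i = begin
          P i ·ˢ v
            ≈⟨ ·ˢ-congˡ v (λ j → trans (*-congˡ (*-comm (w j) s)) (sym (*-assoc (x i) s (w j)))) ⟩
          (λ j → (x i * s) * w j) ·ˢ v
            ≈⟨ ·ˢ-scaleˡ (x i * s) w v ⟩
          x i * s * (w ·ˢ v)
            ≈⟨ *-assoc _ _ _ ⟩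
          x i * (s * (w ·ˢ v)) ∎
          where open K-Reasoning

        A*ᵛ-scaledEigenvector : ∀ c i → A i ·ˢ (λ j → x j * c) ≈ μ * (x i * c)
        A*ᵛ-scaledEigenvector c i = trans (·ˢ-scaleʳ (A i) x c) (trans (*-congʳ (Ax≈μx i)) (*-assoc μ (x i) c))

        cancel-σ : ∀ c → s * (σ * c) ≈ c
        cancel-σ c = trans (sym (*-assoc s σ c))
          (trans (*-congʳ (trans (*-comm s σ) σs≈1)) (*-identityˡ c))

      P-idempotent : (P *ᴹ P) ≈ᴹ P
      P-idempotent i j = begin
        (P *ᵛ λ k → P k j) i                        ≈⟨ P*ᵛ (λ k → P k j) i ⟩
        x i * (s * (w ·ˢ (λ k → x k * (w j * s))))  ≈⟨ *-congˡ (*-congˡ (·ˢ-scaleʳ w x (w j * s))) ⟩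
        x i * (s * (σ * (w j * s)))                 ≈⟨ *-congˡ (cancel-σ (w j * s)) ⟩
        P i j                                       ∎
        where open K-Reasoning

      range⇒eigenspace : ∀ {u v} → (P *ᵛ u) ≈ᵛ v → (A *ᵛ v) ≈ᵛ (μ ·ᵛ v)
      range⇒eigenspace {u} {v} Pu≈v i = begin
        A i ·ˢ v                    ≈⟨ ·ˢ-congʳ (A i) v≈xc ⟩
        A i ·ˢ (λ j → x j * c)      ≈⟨ A*ᵛ-scaledEigenvector c i ⟩
        μ * (x i * c)               ≈⟨ *-congˡ (v≈xc i) ⟨
        μ * v i                     ∎
        where
        open K-Reasoning
        c : Carrier
        c = s * (w ·ˢ u)
        v≈xc : v ≈ᵛ (λ j → x j * c)
        v≈xc j = trans (sym (Pu≈v j)) (P*ᵛ u j)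

      -- Subtracting from `v` its component along `x` leaves an eigenvector for `μ` in the
      -- hyperplane of `w`, or zero. The former is impossible, since eigenvalues there are at most
      -- `ρ < |μ|`.
      eigenspace⇒range : ∀ {v} → (A *ᵛ v) ≈ᵛ (μ ·ᵛ v) → (P *ᵛ v) ≈ᵛ v
      eigenspace⇒range {v} Av≈μv with em {P = ∀ i → v i - x i * (s * (w ·ˢ v)) ≈ 0#}
      ... | yes d≈0 = λ i → trans (P*ᵛ v i) (sym (x∙y⁻¹≈ε⇒x≈y (v i) _ (d≈0 i)))
      ... | no  d≉0 = contradiction
        (∣eigenvalue∣≤-⊥ {A = A} (ℝ.<⇒≤ 0<ρ) ∣A-w∣≤ρ w⊥d (d≉0 , Ad≈μd))
        (ℝ.<⇒≱ (ℝ.<-respʳ-≈ (ℝ.sym ∣μ∣≈ν) ρ<ν))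
        where
        open K-Reasoning
        c : Carrier
        c = s * (w ·ˢ v)
        d : Vector Carrier n
        d i = v i - x i * c
        w⊥d : w ·ˢ d ≈ 0#
        w⊥d = begin
          w ·ˢ d                                ≈⟨ ·ˢ--ʳ w v (λ i → x i * c) ⟨
          w ·ˢ v - w ·ˢ (λ i → x i * c)         ≈⟨ +-congˡ (-‿cong (·ˢ-scaleʳ w x c)) ⟩
          w ·ˢ v - σ * (s * (w ·ˢ v))
            ≈⟨ +-congˡ (-‿cong (trans (sym (*-assoc _ _ _)) (trans (*-congʳ σs≈1) (*-identityˡ _)))) ⟩
          w ·ˢ v - w ·ˢ v                       ≈⟨ -‿inverseʳ _ ⟩
          0#                                    ∎
        factor : ∀ μ u v → μ * u - μ * v ≈ μ * (u - v)
        factor = solve 3 (λ μ u v → μ :* u :- μ :* v := μ :* (u :- v)) refl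
        Ad≈μd : (A *ᵛ d) ≈ᵛ (μ ·ᵛ d)
        Ad≈μd i = begin
          A i ·ˢ d                                ≈⟨ ·ˢ--ʳ (A i) v (λ j → x j * c) ⟨
          A i ·ˢ v - A i ·ˢ (λ j → x j * c)       ≈⟨ +-cong (Av≈μv i) (-‿cong (A*ᵛ-scaledEigenvector c i)) ⟩
          μ * v i - μ * (x i * c)                 ≈⟨ factor μ (v i) (x i * c) ⟩
          μ * d i                                 ∎

      isProjection : IsProjectionOntoEigenspace P A μ
      isProjection = P-idempotent , λ v → mk⇔
        (λ (u , Pu≈v) → range⇒eigenspace {u} Pu≈v)
        (λ Av≈μv → v , eigenspace⇒range Av≈μv)

      private
        M : Matrix n
        M = μ ⁻¹ ·ᴹ A

        -- The column index comes first, so that `deviation k j` is a vector to which `A` can be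
        -- applied.
        deviation : ℕ → Fin n → Vector Carrier n
        deviation k j i = (M ^ᴹ k) i j - P i j

        -- Each column of `P` is a multiple of `x`. Hence the deviations obey the same recursion as
        -- the powers.
        column-P-fixed : ∀ j i → M i ·ˢ (λ l → P l j) ≈ P i j
        column-P-fixed j i = begin
          M i ·ˢ (λ l → P l j)                       ≈⟨ ·ˢ-scaleˡ (μ ⁻¹) (A i) (λ l → P l j) ⟩
          μ ⁻¹ * (A i ·ˢ (λ l → x l * (w j * s)))    ≈⟨ *-congˡ (A*ᵛ-scaledEigenvector (w j * s) i) ⟩
          μ ⁻¹ * (μ * P i j)                         ≈⟨ *-assoc _ _ _ ⟨
          μ ⁻¹ * μ * P i j                           ≈⟨ *-congʳ (⁻¹-inverseˡ μ≉0) ⟩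
          1# * P i j                                 ≈⟨ *-identityˡ _ ⟩
          P i j                                      ∎
          where open K-Reasoning

        deviation-step : ∀ k j i → deviation (suc k) j i ≈ μ ⁻¹ * (A *ᵛ deviation k j) i
        deviation-step k j i = begin
          M i ·ˢ (λ l → (M ^ᴹ k) l j) - P i j
            ≈⟨ +-congˡ (-‿cong (column-P-fixed j i)) ⟨
          M i ·ˢ (λ l → (M ^ᴹ k) l j) - M i ·ˢ (λ l → P l j)
            ≈⟨ ·ˢ--ʳ (M i) (λ l → (M ^ᴹ k) l j) (λ l → P l j) ⟩
          M i ·ˢ deviation k j
            ≈⟨ ·ˢ-scaleˡ (μ ⁻¹) (A i) (deviation k j) ⟩
          μ ⁻¹ * (A *ᵛ deviation k j) i ∎
          where open K-Reasoning

        -- At `k = 0` this says that `P` does not change the pairing with `w`; afterwards the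
        -- hyperplane is invariant because `w` is a left eigenvector.
        w⊥deviation : ∀ k j → w ·ˢ deviation k j ≈ 0#
        w⊥deviation zero j = begin
          w ·ˢ deviation zero j                            ≈⟨ ·ˢ--ʳ w (λ i → 1ᴹ i j) (λ i → P i j) ⟨
          w ·ˢ (λ i → 1ᴹ i j) - w ·ˢ (λ i → P i j)         ≈⟨ +-cong (·ˢ-1ᴹ w j) (-‿cong (·ˢ-scaleʳ w x (w j * s))) ⟩
          w j - σ * (w j * s)                              ≈⟨ +-congˡ (-‿cong (rotate σ (w j) s)) ⟩
          w j - w j * (σ * s)                              ≈⟨ +-congˡ (-‿cong (trans (*-congˡ σs≈1) (*-identityʳ _))) ⟩
          w j - w j                                        ≈⟨ -‿inverseʳ _ ⟩
          0#                                               ∎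
          where
          open K-Reasoning
          rotate : ∀ x y z → x * (y * z) ≈ y * (x * z)
          rotate = solve 3 (λ x y z → x :* (y :* z) := y :* (x :* z)) refl
        w⊥deviation (suc k) j = begin
          w ·ˢ deviation (suc k) j
            ≈⟨ ·ˢ-congʳ w (λ i → trans (deviation-step k j i) (*-comm _ _)) ⟩
          w ·ˢ (λ i → (A *ᵛ deviation k j) i * μ ⁻¹)
            ≈⟨ ·ˢ-scaleʳ w (A *ᵛ deviation k j) (μ ⁻¹) ⟩
          w ·ˢ (A *ᵛ deviation k j) * μ ⁻¹
            ≈⟨ *-congʳ (leftEigenvector-·ˢ {A = A} wA≈μ′w (deviation k j)) ⟩
          μ′ * (w ·ˢ deviation k j) * μ ⁻¹
            ≈⟨ *-congʳ (trans (*-congˡ (w⊥deviation k j)) (zeroʳ _)) ⟩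
          0# * μ ⁻¹
            ≈⟨ zeroˡ _ ⟩
          0# ∎
          where open K-Reasoning

        -- The constant `ν⁻¹` absorbs the denominator `w · x` of `P`. Each further power gains `ρ`
        -- on the hyperplane and divides by `μ`, in total `κ`.
        ∣deviation∣≤ : ∀ k j i → ∣ deviation k j i ∣ ℝ.≤ ν ℝ.⁻¹ ℝ.* κ ℝ.^ k
        ∣deviation∣≤ zero j i = ℝ.≤-respʳ-≈ (ℝ.sym (ℝ.*-identityʳ _))
          (∣-∣≤ (ℝ.≤-trans (∣1ᴹ∣≤1 i j) 1≤ν⁻¹)
            (ℝ.≤-respʳ-≈ (ℝ.trans (ℝ.*-identityˡ _) (ℝ.*-identityˡ _))
              (∣*∣≤ (∣x∣≤1 i) (∣*∣≤ (∣w∣≤1 j) (ℝ.≤-reflexive (∣inverse∣ ∣σ∣≈ν))))))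
        ∣deviation∣≤ (suc k) j i = ℝ.≤-respʳ-≈ (regroup (ν ℝ.⁻¹) ρ (κ ℝ.^ k))
          (ℝ.≤-respˡ-≈ (∣∣-cong (sym (deviation-step k j i)))
            (∣*∣≤ (ℝ.≤-reflexive (∣inverse∣ ∣μ∣≈ν))
              (∣*ᵛ∣≤-⊥ {A = A} (ℝ.<⇒≤ 0<ρ)
                (ℝ.*-nonneg (ℝ.<⇒≤ 0<ν⁻¹) (ℝ.^-nonneg (ℝ.<⇒≤ 0<κ) k))
                ∣A-w∣≤ρ (w⊥deviation k j) (∣deviation∣≤ k j) i)))
          where
          regroup : ∀ i r p → i ℝ.* (r ℝ.* (i ℝ.* p)) ℝ.≈ i ℝ.* ((r ℝ.* i) ℝ.* p)
          regroup i r p = ℝ.*-congˡ (ℝ.sym (ℝ.*-assoc r i p))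

      converges : (λ k → (μ ⁻¹ ·ᴹ A) ^ᴹ k) ⟶ᴹ P
      converges i j 0<δ with N , small ← ℝ.geometric-decay (ℝ.<⇒≤ 0<ν⁻¹) (ℝ.<⇒≤ 0<κ) κ<1 0<δ =
        N , λ k N≤k → ℝ.≤-<-trans (∣deviation∣≤ k j i) (small k N≤k)

-- Evaluation of polynomials and synthetic division

module PolynomialEvaluation {c ℓ} (R : CommutativeRing c ℓ) where
  open List using ([]; _∷_)
  open CommutativeRing R hiding (zero)
  open Polynomials rawRing
  open Matrices rawRing using (Matrix; det; 1ᴹ)
  open Sum semiring using (sum; sum-cong-≋)
  open Exp semiring using (^-congˡ)
  open RawSemiringDefinitions (RawRing.rawSemiring rawRing) using (_^_)
  open RingProperties ring using (-0#≈0#)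
  open Determinant R using (det-cong)
  open IntegerSolver R
  open ≈-Reasoning setoid

  private
    module P where
      open RawSemiringDefinitions (RawRing.rawSemiring polyRing) public using (sum; _^_)
      open Matrices polyRing public using (Matrix; det; 1ᴹ)

  -- Equal polynomials may be lists of different lengths; this disposes of the excess coefficients
  -- in `eval-cong`.
  eval-zero : ∀ p t → (∀ i → coeff p i ≈ 0#) → eval p t ≈ 0#
  eval-zero []      t p≈0 = refl
  eval-zero (x ∷ p) t p≈0 = begin
    x + t * eval p t   ≈⟨ +-cong (p≈0 zero) (*-congˡ (eval-zero p t (p≈0 ∘ suc))) ⟩
    0# + t * 0#        ≈⟨ trans (+-identityˡ _) (zeroʳ t) ⟩
    0#                 ∎

  eval-cong : ∀ p q t → p ≈ᴾ q → eval p t ≈ eval q t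
  eval-cong []      q       t p≈q = sym (eval-zero q t (sym ∘ p≈q))
  eval-cong (x ∷ p) []      t p≈q = eval-zero (x ∷ p) t p≈q
  eval-cong (x ∷ p) (y ∷ q) t p≈q = +-cong (p≈q zero) (*-congˡ (eval-cong p q t (p≈q ∘ suc)))

  eval-+ : ∀ p q t → eval (p +ᴾ q) t ≈ eval p t + eval q t
  eval-+ []      q       t = sym (+-identityˡ _)
  eval-+ (x ∷ p) []      t = sym (+-identityʳ _)
  eval-+ (x ∷ p) (y ∷ q) t = trans (+-congˡ (*-congˡ (eval-+ p q t)))
    (solve 5 (λ x y t u v → (x :+ y) :+ t :* (u :+ v) := (x :+ t :* u) :+ (y :+ t :* v))
      refl x y t (eval p t) (eval q t))

  eval-- : ∀ p t → eval (-ᴾ p) t ≈ - eval p t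
  eval-- []      t = sym -0#≈0#
  eval-- (x ∷ p) t = trans (+-congˡ (*-congˡ (eval-- p t)))
    (solve 3 (λ x t u → :- x :+ t :* :- u := :- (x :+ t :* u)) refl x t (eval p t))

  eval-scale : ∀ x p t → eval (List.map (x *_) p) t ≈ x * eval p t
  eval-scale x []      t = sym (zeroʳ x)
  eval-scale x (y ∷ p) t = trans (+-congˡ (*-congˡ (eval-scale x p t)))
    (solve 4 (λ x y t u → x :* y :+ t :* (x :* u) := x :* (y :+ t :* u)) refl x y t (eval p t))

  eval-* : ∀ p q t → eval (p *ᴾ q) t ≈ eval p t * eval q t
  eval-* []      q t = sym (zeroˡ _)
  eval-* (x ∷ p) q t = begin
    eval (List.map (x *_) q +ᴾ (0# ∷ p *ᴾ q)) t
      ≈⟨ eval-+ (List.map (x *_) q) (0# ∷ p *ᴾ q) t ⟩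
    eval (List.map (x *_) q) t + (0# + t * eval (p *ᴾ q) t)
      ≈⟨ +-cong (eval-scale x q t) (+-congˡ (*-congˡ (eval-* p q t))) ⟩
    x * eval q t + (0# + t * (eval p t * eval q t))
      ≈⟨ solve 4 (λ x t u v → x :* v :+ (con (+ 0) :+ t :* (u :* v)) := (x :+ t :* u) :* v)
           refl x t (eval p t) (eval q t) ⟩
    (x + t * eval p t) * eval q t ∎

  eval-const : ∀ x t → eval (const x) t ≈ x
  eval-const x t = trans (+-congˡ (zeroʳ t)) (+-identityʳ x)

  eval-^ : ∀ p k t → eval (p P.^ k) t ≈ eval p t ^ k
  eval-^ p zero    t = eval-const 1# t
  eval-^ p (suc k) t = trans (eval-* p (p P.^ k) t) (*-congˡ (eval-^ p k t))

  eval-sum : ∀ {n} (f : Vector Poly n) t → eval (P.sum f) t ≈ sum (λ i → eval (f i) t)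
  eval-sum {zero}  f t = refl
  eval-sum {suc n} f t = trans (eval-+ (f zero) _ t) (+-congˡ (eval-sum (f ∘ suc) t))

  eval-det : ∀ {n} (M : P.Matrix n) t → eval (P.det M) t ≈ det (λ i j → eval (M i j) t)
  eval-det {zero}  M t = eval-const 1# t
  eval-det {suc n} M t = trans (eval-sum term t) (sum-cong-≋ {x = λ j → eval (term j) t} λ j → begin
    eval (term j) t
      ≈⟨ eval-* (sign j) (M zero j *ᴾ P.det (minor j)) t ⟩
    eval (sign j) t * eval (M zero j *ᴾ P.det (minor j)) t
      ≈⟨ *-cong
           (trans (eval-^ (-ᴾ const 1#) (toℕ j) t) (^-congˡ (toℕ j) (eval-const (- 1#) t)))
           (trans (eval-* (M zero j) (P.det (minor j)) t) (*-congˡ (eval-det (minor j) t))) ⟩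
    (- 1#) ^ toℕ j * (eval (M zero j) t * det (λ i k → eval (minor j i k) t)) ∎)
    where
    sign : Fin (suc n) → Poly
    sign j = (-ᴾ const 1#) P.^ toℕ j
    minor : Fin (suc n) → P.Matrix n
    minor j i k = M (suc i) (punchIn j k)
    term : Vector Poly (suc n)
    term j = sign j *ᴾ (M zero j *ᴾ P.det (minor j))

  eval-charPoly : ∀ {n} (A : Matrix n) t →
                  eval (charPoly A) t ≈ det (λ i j → t * 1ᴹ i j - A i j)
  eval-charPoly A t = trans (eval-det (λ i j → (X *ᴾ P.1ᴹ i j) +ᴾ -ᴾ const (A i j)) t)
    (det-cong λ i j → begin
      eval ((X *ᴾ P.1ᴹ i j) +ᴾ -ᴾ const (A i j)) t
        ≈⟨ eval-+ (X *ᴾ P.1ᴹ i j) (-ᴾ const (A i j)) t ⟩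
      eval (X *ᴾ P.1ᴹ i j) t + eval (-ᴾ const (A i j)) t
        ≈⟨ +-cong (trans (eval-* X (P.1ᴹ i j) t) (*-cong eval-X (eval-if (does (i ≟ j)))))
                  (trans (eval-- (const (A i j)) t) (-‿cong (eval-const (A i j) t))) ⟩
      t * 1ᴹ i j - A i j ∎)
    where
    eval-X : eval X t ≈ t
    eval-X = solve 1 (λ t → con (+ 0) :+ t :* (con (+ 1) :+ t :* con (+ 0)) := t) refl t
    -- Both identity matrices branch on the same Boolean, which is abstracted so that each branch
    -- reduces.
    eval-if : ∀ b → eval (if b then const 1# else []) t ≈ (if b then 1# else 0#)
    eval-if true  = eval-const 1# t
    eval-if false = refl

  coeff-+ : ∀ p q i → coeff (p +ᴾ q) i ≈ coeff p i + coeff q i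
  coeff-+ []      q       i       = sym (+-identityˡ _)
  coeff-+ (x ∷ p) []      i       = sym (+-identityʳ _)
  coeff-+ (x ∷ p) (y ∷ q) zero    = refl
  coeff-+ (x ∷ p) (y ∷ q) (suc i) = coeff-+ p q i

  -- Horner's scheme: the quotient by `X - t` has as coefficients the values at `t` of the
  -- successive tails of `p`, ending in a harmless trailing zero when `p` is nonempty.
  syntheticQuotient : Poly → Carrier → Poly
  syntheticQuotient []      t = []
  syntheticQuotient (x ∷ p) t = eval p t ∷ syntheticQuotient p t

  -- The divisor has coefficients known only up to `≈`, because the first power of `X - t` computes
  -- to unsimplified expressions for `- t` and `1#`.
  syntheticDivision : ∀ p t {d₀ d₁} → d₀ ≈ - t → d₁ ≈ 1# → ∀ i →
    coeff (syntheticQuotient p t *ᴾ (d₀ ∷ d₁ ∷ [])) i + coeff (const (eval p t)) i ≈ coeff p i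
  syntheticDivision []      t           d₀≈-t d₁≈1 zero    = +-identityˡ _
  syntheticDivision []      t           d₀≈-t d₁≈1 (suc i) = +-identityˡ _
  syntheticDivision (x ∷ p) t {d₀}      d₀≈-t d₁≈1 zero    = begin
    (r * d₀ + 0#) + (x + t * r)     ≈⟨ +-congʳ (+-congʳ (*-congˡ d₀≈-t)) ⟩
    (r * - t + 0#) + (x + t * r)
      ≈⟨ solve 3 (λ r t x → (r :* :- t :+ con (+ 0)) :+ (x :+ t :* r) := x) refl r t x ⟩
    x                               ∎
    where r = eval p t
  syntheticDivision (x ∷ p) t {d₀} {d₁} d₀≈-t d₁≈1 (suc i) = begin
    coeff (const (r * d₁) +ᴾ q*d) i + 0#    ≈⟨ +-identityʳ _ ⟩
    coeff (const (r * d₁) +ᴾ q*d) i         ≈⟨ coeff-+ (const (r * d₁)) q*d i ⟩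
    coeff (const (r * d₁)) i + coeff q*d i  ≈⟨ +-congʳ (coeff-const i (trans (*-congˡ d₁≈1) (*-identityʳ r))) ⟩
    coeff (const r) i + coeff q*d i         ≈⟨ +-comm _ _ ⟩
    coeff q*d i + coeff (const r) i         ≈⟨ syntheticDivision p t d₀≈-t d₁≈1 i ⟩
    coeff p i                               ∎
    where
    r = eval p t
    q*d = syntheticQuotient p t *ᴾ (d₀ ∷ d₁ ∷ [])
    coeff-const : ∀ {x y} i → x ≈ y → coeff (const x) i ≈ coeff (const y) i
    coeff-const zero    x≈y = x≈y
    coeff-const (suc i) x≈y = refl

  root⇒factor : ∀ p t → eval p t ≈ 0# → ∃ λ q → (q *ᴾ ((X +ᴾ -ᴾ const t) P.^ 1)) ≈ᴾ p
  root⇒factor p t p[t]≈0 = syntheticQuotient p t , λ i → begin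
    coeff q*d i                             ≈⟨ +-identityʳ _ ⟨
    coeff q*d i + 0#                        ≈⟨ +-congˡ (coeff-const i) ⟨
    coeff q*d i + coeff (const (eval p t)) i
      ≈⟨ syntheticDivision p t
           (solve 1 (λ t → (con (+ 0) :+ :- t) :* con (+ 1) :+ con (+ 0) := :- t) refl t)
           (solve 0 (con (+ 1) :* con (+ 1) :+ con (+ 0) := con (+ 1)) refl) i ⟩
    coeff p i                               ∎
    where
    q*d = syntheticQuotient p t *ᴾ ((X +ᴾ -ᴾ const t) P.^ 1)
    coeff-const : ∀ i → coeff (const (eval p t)) i ≈ 0#
    coeff-const zero    = p[t]≈0
    coeff-const (suc i) = refl

  eval-linear : ∀ x t → eval (X +ᴾ -ᴾ const x) t ≈ t - x
  eval-linear x t =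
    solve 2 (λ x t → (con (+ 0) :+ :- x) :+ t :* (con (+ 1) :+ t :* con (+ 0)) := t :- x) refl x t

  eval-double : ∀ q x t →
    eval (q *ᴾ ((X +ᴾ -ᴾ const x) P.^ 2)) t ≈ (t - x) * (eval q t * (t - x))
  eval-double q x t = begin
    eval (q *ᴾ ((X +ᴾ -ᴾ const x) P.^ 2)) t
      ≈⟨ eval-* q ((X +ᴾ -ᴾ const x) P.^ 2) t ⟩
    eval q t * eval ((X +ᴾ -ᴾ const x) P.^ 2) t
      ≈⟨ *-congˡ (trans (eval-^ (X +ᴾ -ᴾ const x) 2 t) (^-congˡ 2 (eval-linear x t))) ⟩
    eval q t * ((t - x) * ((t - x) * 1#))
      ≈⟨ rearrange (eval q t) (t - x) ⟩
    (t - x) * (eval q t * (t - x)) ∎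
    where
    rearrange : ∀ q d → q * (d * (d * 1#)) ≈ d * (q * d)
    rearrange = solve 2 (λ q d → q :* (d :* (d :* con (+ 1))) := d :* (q :* d)) refl

-- Algebraic simplicity

module SimpleEigenvalue {a} (em : ExcludedMiddle a) {ℝ : Reals a}
  (K : NonArchimedeanField ℝ) where
  open List using ([]; _∷_)
  open NonArchimedeanField K hiding (zero)
  open Polynomials rawRing using
    (Poly; eval; charPoly; HasRootOfMultiplicity; polyRing; const; X; _+ᴾ_; _*ᴾ_; -ᴾ_; _≈ᴾ_)
  open FieldProperties em baseField
  open NonArchimedeanProperties em K
  open DominantEigenvalue em K
  open PolynomialEvaluation commutativeRing
  open Determinant commutativeRing using (det-cong; det-deflate)
  open IntegerSolver commutativeRing

  private
    module ℝ = RealArithmetic em ℝ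

    ∣sign*∣ : ∀ k x → ∣ (- 1#) ^ k * x ∣ ℝ.≈ ∣ x ∣
    ∣sign*∣ k x = ℝ.trans (∣∣-* ((- 1#) ^ k) x) (ℝ.trans (ℝ.*-congʳ (∣sign∣ k)) (ℝ.*-identityˡ _))
      where
      ∣sign∣ : ∀ k → ∣ (- 1#) ^ k ∣ ℝ.≈ ℝ.1#
      ∣sign∣ zero    = ∣1∣
      ∣sign∣ (suc k) = ℝ.trans (∣∣-* (- 1#) ((- 1#) ^ k))
        (ℝ.trans (ℝ.*-cong ∣-1∣ (∣sign∣ k)) (ℝ.*-identityˡ _))

  ∣det∣≤ : ∀ {n} {M : Matrix n} {r} → ℝ.0# ℝ.≤ r → (∀ i j → ∣ M i j ∣ ℝ.≤ r) → ∣ det M ∣ ℝ.≤ r ℝ.^ n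
  ∣det∣≤ {zero}      0≤r ∣M∣≤r = ℝ.≤-reflexive ∣1∣
  ∣det∣≤ {suc n} {M} 0≤r ∣M∣≤r = ∣sum∣≤ (ℝ.^-nonneg 0≤r (suc n)) λ j →
    ℝ.≤-respˡ-≈ (ℝ.sym (∣sign*∣ (toℕ j) _))
      (∣*∣≤ (∣M∣≤r zero j) (∣det∣≤ 0≤r λ i k → ∣M∣≤r (suc i) (punchIn j k)))

  -- In the first-row expansion the corner term has the full power of `|t|` by induction. Every
  -- other term has a first-row entry of size at most `ρ < |t|` and a minor bounded by the remaining
  -- power of `|t|`, so it is strictly smaller.
  ∣det[t-C]∣ : ∀ {n} (C : Matrix n) {t ρ} → ρ ℝ.< ∣ t ∣ → (∀ i j → ∣ C i j ∣ ℝ.≤ ρ) →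
               ∣ det (λ i j → t * 1ᴹ i j - C i j) ∣ ℝ.≈ ∣ t ∣ ℝ.^ n
  ∣det[t-C]∣ {zero}  C         ρ<∣t∣ ∣C∣≤ρ = ∣1∣
  ∣det[t-C]∣ {suc n} C {t} {ρ} ρ<∣t∣ ∣C∣≤ρ = ℝ.trans
    (isosceles (ℝ.<-respˡ-≈ (∣∣-cong (drop-first (term zero) _)) (ℝ.<-respʳ-≈ (ℝ.sym ∣first∣)
      (∣sum∣< (ℝ.^-positive 0<∣t∣ (suc n)) ∣rest∣<))))
    ∣first∣
    where
    open ℝ-Reasoning
    -- Positivity comes from an entry of `C`, which exists because the matrix is not empty:
    -- `0 ≤ |C zero zero| ≤ ρ < |t|`.
    0<∣t∣ : ℝ.0# ℝ.< ∣ t ∣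
    0<∣t∣ = ℝ.≤-<-trans (ℝ.≤-trans (∣∣-nonneg (C zero zero)) (∣C∣≤ρ zero zero)) ρ<∣t∣
    N : Matrix (suc n)
    N i j = t * 1ᴹ i j - C i j
    minor : Fin (suc n) → Carrier
    minor j = det (λ i k → N (suc i) (punchIn j k))
    term : Vector Carrier (suc n)
    term j = (- 1#) ^ toℕ j * (N zero j * minor j)
    drop-first : ∀ x y → y ≈ (x + y) - x
    drop-first = solve 2 (λ x y → y := (x :+ y) :- x) refl
    ∣N₀₀∣ : ∣ N zero zero ∣ ℝ.≈ ∣ t ∣
    ∣N₀₀∣ = isosceles (ℝ.≤-<-trans
      (ℝ.≤-respˡ-≈ (ℝ.sym (ℝ.trans (∣∣-cong (collapse t (C zero zero))) (∣-x∣ _))) (∣C∣≤ρ zero zero)) ρ<∣t∣)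
      where
      collapse : ∀ t c → (t * 1# - c) - t ≈ - c
      collapse = solve 2 (λ t c → (t :* con (+ 1) :- c) :- t := :- c) refl
    ∣first∣ : ∣ term zero ∣ ℝ.≈ ∣ t ∣ ℝ.^ suc n
    ∣first∣ = ℝ.trans (∣sign*∣ 0 _) (ℝ.trans (∣∣-* _ _)
      (ℝ.*-cong ∣N₀₀∣ (∣det[t-C]∣ (λ i j → C (suc i) (suc j)) ρ<∣t∣ λ i j → ∣C∣≤ρ (suc i) (suc j))))
    ∣t*1ᴹ∣≤ : ∀ {m} (i j : Fin m) → ∣ t * 1ᴹ i j ∣ ℝ.≤ ∣ t ∣
    ∣t*1ᴹ∣≤ i j = ℝ.≤-respʳ-≈ (ℝ.*-identityʳ _) (∣*∣≤ ℝ.≤-refl (∣1ᴹ∣≤1 i j))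
    ∣N∣≤ : ∀ i j → ∣ N i j ∣ ℝ.≤ ∣ t ∣
    ∣N∣≤ i j = ∣-∣≤ (∣t*1ᴹ∣≤ i j) (ℝ.≤-trans (∣C∣≤ρ i j) (ℝ.<⇒≤ ρ<∣t∣))
    ∣N₀∣≤ : ∀ j → ∣ N zero (suc j) ∣ ℝ.≤ ρ
    ∣N₀∣≤ j = ℝ.≤-respˡ-≈
      (ℝ.sym (ℝ.trans (∣∣-cong (trans (+-congʳ (zeroʳ t)) (+-identityˡ _))) (∣-x∣ _)))
      (∣C∣≤ρ zero (suc j))
    ∣rest∣< : ∀ j → ∣ term (suc j) ∣ ℝ.< ∣ t ∣ ℝ.^ suc n
    ∣rest∣< j = begin-strict
      ∣ term (suc j) ∣                        ≈⟨ ∣sign*∣ (suc (toℕ j)) _ ⟩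
      ∣ N zero (suc j) * minor (suc j) ∣      ≤⟨ ∣*∣≤ (∣N₀∣≤ j) (∣det∣≤ (∣∣-nonneg t)
                                                   λ i k → ∣N∣≤ (suc i) (punchIn (suc j) k)) ⟩
      ρ ℝ.* ∣ t ∣ ℝ.^ n                       <⟨ ℝ.*-monoˡ-< (ℝ.^-positive 0<∣t∣ n) ρ<∣t∣ ⟩
      ∣ t ∣ ℝ.* ∣ t ∣ ℝ.^ n                   ∎

  -- On the unit disc Horner's recursion never exceeds the largest absolute value of a coefficient.
  -- Such a uniform bound lets one factor `τᵏ` drive the product with `eval q` to 0.
  eval-bounded : ∀ q → ∃ λ B → ℝ.0# ℝ.≤ B × (∀ t → ∣ t ∣ ℝ.≤ ℝ.1# → ∣ eval q t ∣ ℝ.≤ B)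
  eval-bounded []      = ℝ.0# , ℝ.≤-refl , λ t _ → ℝ.≤-reflexive ∣0∣
  eval-bounded (x ∷ q) with B , 0≤B , ∣q∣≤B ← eval-bounded q =
    ℝ.max ∣ x ∣ B , ℝ.≤-trans 0≤B (ℝ.x≤y⊔x ∣ x ∣ B) , λ t ∣t∣≤1 →
      ∣+∣≤ (ℝ.x≤x⊔y ∣ x ∣ B)
           (ℝ.≤-trans (ℝ.≤-respʳ-≈ (ℝ.*-identityˡ B) (∣*∣≤ ∣t∣≤1 (∣q∣≤B t ∣t∣≤1))) (ℝ.x≤y⊔x ∣ x ∣ B))

  -- If (X - μ)² divided p, then c (t) would tend to 0 as t = μ + τᵏ tends to μ.
  simpleRoot : ∀ {p μ τ r δ} {c : Carrier → Carrier} → τ ≉ 0# → ∣ τ ∣ ℝ.< ℝ.1# → ∣ μ ∣ ℝ.≤ ℝ.1# → ℝ.0# ℝ.< r → ℝ.0# ℝ.< δ →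
    (∀ t → eval p t ≈ (t - μ) * c t) → (∀ t → ∣ t - μ ∣ ℝ.< r → δ ℝ.≤ ∣ c t ∣) →
    HasRootOfMultiplicity p μ 1
  simpleRoot {p} {μ} {τ} {r} {δ} {c} τ≉0 ∣τ∣<1 ∣μ∣≤1 0<r 0<δ p≈[t-μ]c δ≤∣c∣ =
    (let q , q*d≈p = root⇒factor p μ p[μ]≈0 in q RawMagmaDefinitions., q*d≈p) ,
    λ (q RawMagmaDefinitions., q*d²≈p) → not-double q q*d²≈p
    where
    p[μ]≈0 : eval p μ ≈ 0#
    p[μ]≈0 = trans (p≈[t-μ]c μ) (trans (*-congʳ (-‿inverseʳ μ)) (zeroˡ _))

    _^ᴾ_ : Poly → ℕ → Poly
    _^ᴾ_ = RawSemiringDefinitions._^_ (RawRing.rawSemiring polyRing)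

    not-double : ∀ q → ¬ (q *ᴾ ((X +ᴾ -ᴾ const μ) ^ᴾ 2)) ≈ᴾ p
    not-double q q*d²≈p = absurd (eval-bounded q)
      where
      ∣h∣→0 : ∀ {ε} → ℝ.0# ℝ.< ε → ∃ λ N → ∀ k → N ℕ.≤ k → ℝ.1# ℝ.* ∣ τ ∣ ℝ.^ k ℝ.< ε
      ∣h∣→0 = ℝ.geometric-decay (ℝ.<⇒≤ ℝ.0<1) (∣∣-nonneg τ) ∣τ∣<1

      absurd : ¬ ∃ λ B → ℝ.0# ℝ.≤ B × (∀ t → ∣ t ∣ ℝ.≤ ℝ.1# → ∣ eval q t ∣ ℝ.≤ B)
      absurd (B , 0≤B , ∣q∣≤B) =
        choose (∣h∣→0 0<r) (ℝ.geometric-decay 0≤B (∣∣-nonneg τ) ∣τ∣<1 0<δ)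
        where
        choose : (∃ λ N → ∀ k → N ℕ.≤ k → ℝ.1# ℝ.* ∣ τ ∣ ℝ.^ k ℝ.< r) →
                 ¬ (∃ λ N → ∀ k → N ℕ.≤ k → B ℝ.* ∣ τ ∣ ℝ.^ k ℝ.< δ)
        choose (N , near) (N′ , small) = ℝ.<⇒≱ (small k (ℕ.m≤n⊔m N N′)) (begin
          δ                      ≤⟨ δ≤∣c∣ t ∣t-μ∣<r ⟩
          ∣ c t ∣                ≈⟨ ∣∣-cong c[t]≈q[t]h ⟩
          ∣ eval q t * h ∣       ≤⟨ ∣*∣≤ (∣q∣≤B t ∣t∣≤1) (ℝ.≤-reflexive (∣^∣ τ k)) ⟩
          B ℝ.* ∣ τ ∣ ℝ.^ k      ∎)
          where
          open ℝ-Reasoning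
          -- Passing `N` brings `t` into the disc where `c` is bounded below; passing `N′` makes
          -- `B |τ|ᵏ` smaller than `δ`.
          k : ℕ
          k = N ℕ.⊔ N′
          h t : Carrier
          h = τ ^ k
          t = μ + h
          t-μ≈h : t - μ ≈ h
          t-μ≈h = cancel μ h
            where
            cancel : ∀ x y → (x + y) - x ≈ y
            cancel = solve 2 (λ x y → (x :+ y) :- x := y) refl
          ∣t-μ∣<r : ∣ t - μ ∣ ℝ.< r
          ∣t-μ∣<r = ℝ.<-respˡ-≈
            (ℝ.trans (ℝ.*-identityˡ _) (ℝ.sym (ℝ.trans (∣∣-cong t-μ≈h) (∣^∣ τ k))))
            (near k (ℕ.m≤m⊔n N N′))
          ∣t∣≤1 : ∣ t ∣ ℝ.≤ ℝ.1#
          ∣t∣≤1 = ∣+∣≤ ∣μ∣≤1 (ℝ.≤-respˡ-≈ (ℝ.sym (∣^∣ τ k))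
            (ℝ.^-antitone (∣∣-nonneg τ) (ℝ.<⇒≤ ∣τ∣<1) {k = k} ℕ.z≤n))
          -- No power of the nonzero `τ` vanishes, so one factor `t - μ` may be cancelled.
          t-μ≉0 : t - μ ≉ 0#
          t-μ≉0 t-μ≈0 = ∣∣-positive⁻¹
            (ℝ.<-respʳ-≈ (ℝ.sym (∣^∣ τ k)) (ℝ.^-positive (∣∣-positive τ≉0) k))
            (trans (sym t-μ≈h) t-μ≈0)
          c[t]≈q[t]h : c t ≈ eval q t * h
          c[t]≈q[t]h = *-cancelˡ t-μ≉0 (K-Reasoning.begin
            (t - μ) * c t                  K-Reasoning.≈⟨ p≈[t-μ]c t ⟨
            eval p t                       K-Reasoning.≈⟨ eval-cong (q *ᴾ ((X +ᴾ -ᴾ const μ) ^ᴾ 2)) p t q*d²≈p ⟨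
            eval (q *ᴾ ((X +ᴾ -ᴾ const μ) ^ᴾ 2)) t
                                           K-Reasoning.≈⟨ eval-double q μ t ⟩
            (t - μ) * (eval q t * (t - μ)) K-Reasoning.≈⟨ *-congˡ (*-congˡ t-μ≈h) ⟩
            (t - μ) * (eval q t * h)       K-Reasoning.∎)

  -- The vector `x` is also an eigenvector of `t - A`, for `t - μ`, so `det-deflate` applies at each
  -- value of `t`. The remaining block has the form `t - C` because `t` does not occur off the
  -- diagonal in the first row.
  charPoly-deflate : ∀ {m} (A : Matrix (suc m)) {x : Vector Carrier (suc m)} {μ} →
    x zero ≈ 1# → (A *ᵛ x) ≈ᵛ (μ ·ᵛ x) → ∀ t →
    eval (charPoly A) t ≈
    (t - μ) * det (λ i j → t * 1ᴹ i j - (A (suc i) (suc j) - x (suc i) * A zero (suc j)))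
  charPoly-deflate A {x} {μ} x₀≈1 Ax≈μx t = begin
    eval (charPoly A) t
      ≈⟨ eval-charPoly A t ⟩
    det N
      ≈⟨ det-deflate N (x ∘ suc) (t - μ) eigen ⟩
    (t - μ) * det (λ i j → N (suc i) (suc j) - x (suc i) * N zero (suc j))
      ≈⟨ *-congˡ (det-cong λ i j →
           rearrange (t * 1ᴹ i j) (A (suc i) (suc j)) (x (suc i)) t (A zero (suc j))) ⟩
    (t - μ) * det (λ i j → t * 1ᴹ i j - (A (suc i) (suc j) - x (suc i) * A zero (suc j))) ∎
    where
    open K-Reasoning
    N : Matrix _
    N i j = t * 1ᴹ i j - A i j
    rearrange : ∀ d a x t b → (d - a) - x * (t * 0# - b) ≈ d - (a - x * b)
    rearrange = solve 5 (λ d a x t b → (d :- a) :- x :* (t :* con (+ 0) :- b) := d :- (a :- x :* b)) refl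
    -- `det-deflate` expects a literal `1#` in front, whereas `x zero` is only `≈ 1#`.
    x̂ : Vector Carrier _
    x̂ = 1# Vector.∷ x ∘ suc
    x̂≈x : x̂ ≈ᵛ x
    x̂≈x zero    = sym x₀≈1
    x̂≈x (suc i) = refl
    factor : ∀ t μ x → t * x - μ * x ≈ (t - μ) * x
    factor = solve 3 (λ t μ x → t :* x :- μ :* x := (t :- μ) :* x) refl
    eigen : (N *ᵛ x̂) ≈ᵛ ((t - μ) ·ᵛ x̂)
    eigen i = begin
      N i ·ˢ x̂                                  ≈⟨ ·ˢ-congʳ (N i) x̂≈x ⟩
      N i ·ˢ x                                  ≈⟨ ·ˢ--ˡ (λ j → t * 1ᴹ i j) (A i) x ⟨
      (λ j → t * 1ᴹ i j) ·ˢ x - A i ·ˢ x        ≈⟨ +-cong (trans (·ˢ-scaleˡ t (1ᴹ i) x) (*-congˡ (1ᴹ-·ˢ x i)))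
                                                          (-‿cong (Ax≈μx i)) ⟩
      t * x i - μ * x i                         ≈⟨ factor t μ (x i) ⟩
      (t - μ) * x i                             ≈⟨ *-congˡ (x̂≈x i) ⟨
      (t - μ) * x̂ i                             ∎

-- Transport along isometric embeddings

module _ {a} {ℝ : Reals a} {K L : NonArchimedeanField ℝ}
  {ι : NonArchimedeanField.Carrier K → NonArchimedeanField.Carrier L}
  (isometric : IsIsometricEmbedding K L ι) where
  private
    module K where
      open NonArchimedeanField K public
      open Sum (CommutativeRing.semiring commutativeRing) public using (sum)
    module L where
      open NonArchimedeanField L public
      open Sum (CommutativeRing.semiring commutativeRing) public using (sum)
  open IsIsometricEmbedding isometric using (isFieldHomomorphism)
  open RingMorphisms.IsRingHomomorphism isFieldHomomorphism

  sum-homo : ∀ {n} (f : Vector K.Carrier n) → ι (K.sum f) L.≈ L.sum (ι ∘ f)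
  sum-homo {zero}  f = 0#-homo
  sum-homo {suc n} f = L.trans (+-homo (f zero) _) (L.+-congˡ (sum-homo (f ∘ suc)))

  difference-homo : ∀ x y → ι (x K.- y) L.≈ ι x L.- ι y
  difference-homo x y = L.trans (+-homo x (K.- y)) (L.+-congˡ (-‿homo y))

isometric-∘ : ∀ {a} {ℝ : Reals a} {K L M : NonArchimedeanField ℝ} {f g} →
              IsIsometricEmbedding K L f → IsIsometricEmbedding L M g → IsIsometricEmbedding K M (g ∘ f)
isometric-∘ {ℝ = ℝ} {M = M} {f} f-iso g-iso = record
  { isFieldHomomorphism = Composition.isRingHomomorphism M.trans
      (isFieldHomomorphism f-iso) (isFieldHomomorphism g-iso)
  ; isometric           = λ x → ℝ.trans (isometric g-iso (f x)) (isometric f-iso x)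
  }
  where
  module M = NonArchimedeanField M
  module ℝ = Reals ℝ
  open IsIsometricEmbedding

-- The uniformizer and the size of the perturbation

module Uniformizer {a} (em : ExcludedMiddle a) {ℝ : Reals a}
  (K : NonArchimedeanField ℝ) where
  open NonArchimedeanField K hiding (zero)
  open FieldProperties em baseField
  open Inverse em baseField using (_⁻¹)
  open NonArchimedeanProperties em K

  private
    module ℝ = RealArithmetic em ℝ

  module _ {π : Carrier} (uniformizer : IsUniformizer π)
    {ord : Carrier → ℤ ⁺} (valuation : IsNormalizedValuation em K π ord) where
    open IsNormalizedValuation valuation

    -- If `|π|` were 1, then `π⁻¹` would be integral and 1 would lie in the proper ideal generated
    -- by `π`.
    ∣π∣<1 : ∣ π ∣ ℝ.< ℝ.1#
    ∣π∣<1 with ℝ.compare ∣ π ∣ ℝ.1#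
    ... | tri< ∣π∣<1 _ _ = ∣π∣<1
    ... | tri> _ _ 1<∣π∣ = contradiction (IsUniformizer.integral uniformizer) (ℝ.<⇒≱ 1<∣π∣)
    ... | tri≈ _ ∣π∣≈1 _ = contradiction
      (π ⁻¹ , ℝ.≤-reflexive ∣π⁻¹∣≈1 , sym (⁻¹-inverseʳ π≉0))
      (IsMaximalIdeal.proper (IsUniformizer.isMaximal uniformizer))
      where
      π≉0 : π ≉ 0#
      π≉0 = ∣∣-positive⁻¹ (ℝ.<-respʳ-≈ (ℝ.sym ∣π∣≈1) ℝ.0<1)
      ∣π⁻¹∣≈1 : ∣ π ⁻¹ ∣ ℝ.≈ ℝ.1#
      ∣π⁻¹∣≈1 = begin-equality
        ∣ π ⁻¹ ∣               ≈⟨ ℝ.*-identityˡ _ ⟨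
        ℝ.1# ℝ.* ∣ π ⁻¹ ∣      ≈⟨ ℝ.*-congʳ ∣π∣≈1 ⟨
        ∣ π ∣ ℝ.* ∣ π ⁻¹ ∣     ≈⟨ ∣∣-* π (π ⁻¹) ⟨
        ∣ π * π ⁻¹ ∣           ≈⟨ ∣∣-cong (⁻¹-inverseʳ π≉0) ⟩
        ∣ 1# ∣                 ≈⟨ ∣1∣ ⟩
        ℝ.1#                   ∎
        where open ℝ-Reasoning

    -- Since 0⁻¹ = 0, the powers of ∣ 0 ∣ are only 0 and 1.
    π≉0 : IsNontrivial → π ≉ 0#
    π≉0 (x , x≉0 , ∣x∣≉1) π≈0 = absurd (ord x) (∣x∣≈∣π∣^ord x)
      where
      ∣x∣≉0 : ¬ ∣ x ∣ ℝ.≈ ℝ.0#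
      ∣x∣≉0 = x≉0 ∘ ∣∣-definite
      ∣π∣^suc≈0 : ∀ k → ∣ π ∣ ℝ.^ suc k ℝ.≈ ℝ.0#
      ∣π∣^suc≈0 k = ℝ.trans (ℝ.*-congʳ (ℝ.trans (∣∣-cong π≈0) ∣0∣)) (ℝ.zeroˡ _)
      absurd : ∀ o → ¬ ∣ x ∣ ℝ.≈ _^⁺_ em K ∣ π ∣ o
      absurd ⊤⁺           ∣x∣≈0   = ∣x∣≉0 ∣x∣≈0
      absurd [ + zero ]   ∣x∣≈1   = ∣x∣≉1 ∣x∣≈1
      absurd [ + suc k ]  ∣x∣≈π^k = ∣x∣≉0 (ℝ.trans ∣x∣≈π^k (∣π∣^suc≈0 k))
      absurd [ -[1+ k ] ] ∣x∣≈π^k = ∣x∣≉0 (ℝ.trans ∣x∣≈π^k (ℝ.⁻¹-zero (∣π∣^suc≈0 k)))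

    -- For `ord n = k` the hypothesis means `ℓ ≥ 2k + 1`, and the one extra factor `|π| < 1` makes
    -- the inequality strict.
    ∣π∣^ℓ<∣n∣² : IsNontrivial → ∀ n ℓ → twice (ord (fromℕ n)) <⁺ [ + ℓ ] →
                 ∣ π ∣ ℝ.^ ℓ ℝ.< ∣ fromℕ n ∣ ℝ.* ∣ fromℕ n ∣
    ∣π∣^ℓ<∣n∣² nontrivial n ℓ = compute (ord (fromℕ n)) (∣x∣≈∣π∣^ord (fromℕ n))
      where
      open ℝ-Reasoning
      ν : ℝ.Carrier
      ν = ∣ fromℕ n ∣
      0<∣π∣ : ℝ.0# ℝ.< ∣ π ∣
      0<∣π∣ = ∣∣-positive (π≉0 nontrivial)
      ∣π∣^suc< : ∀ k → ∣ π ∣ ℝ.^ suc k ℝ.< ∣ π ∣ ℝ.^ k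
      ∣π∣^suc< k = ℝ.<-respʳ-≈ (ℝ.*-identityˡ _) (ℝ.*-monoˡ-< (ℝ.^-positive 0<∣π∣ k) ∣π∣<1)
      compute : ∀ o → ν ℝ.≈ _^⁺_ em K ∣ π ∣ o → twice o <⁺ [ + ℓ ] → ∣ π ∣ ℝ.^ ℓ ℝ.< ν ℝ.* ν
      compute [ + k ] ν≈π^k [ 2k<ℓ ] = begin-strict
        ∣ π ∣ ℝ.^ ℓ                        ≤⟨ ℝ.^-antitone (ℝ.<⇒≤ 0<∣π∣) (ℝ.<⇒≤ ∣π∣<1) k+k<ℓ ⟩
        ∣ π ∣ ℝ.^ suc (k ℕ.+ k)            <⟨ ∣π∣^suc< (k ℕ.+ k) ⟩
        ∣ π ∣ ℝ.^ (k ℕ.+ k)                ≈⟨ ℝ.^-homo-* ∣ π ∣ k k ⟩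
        ∣ π ∣ ℝ.^ k ℝ.* ∣ π ∣ ℝ.^ k        ≈⟨ ℝ.*-cong ν≈π^k ν≈π^k ⟨
        ν ℝ.* ν                            ∎
        where
        k+k<ℓ : k ℕ.+ k ℕ.< ℓ
        k+k<ℓ = ≡.subst (ℕ._< ℓ) (≡.cong (k ℕ.+_) (ℕ.+-identityʳ k))
          (ℤ.drop‿+<+ (≡.subst (ℤ._< + ℓ) (≡.sym (ℤ.pos-* 2 k)) 2k<ℓ))
      -- A negative order would make `|n|` exceed 1, which is impossible for an integer.
      compute [ -[1+ k ] ] ν≈π^-k _ = contradiction (begin-strict
        ℝ.1#                          ≈⟨ ℝ.⁻¹-inverseˡ (ℝ.<⇒≉ (ℝ.^-positive 0<∣π∣ (suc k))) ⟨
        (∣ π ∣ ℝ.^ suc k) ℝ.⁻¹ ℝ.* ∣ π ∣ ℝ.^ suc k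
                                      ≈⟨ ℝ.*-congʳ ν≈π^-k ⟨
        ν ℝ.* ∣ π ∣ ℝ.^ suc k         ≤⟨ ℝ.*-monoˡ-≤ (ℝ.<⇒≤ (ℝ.^-positive 0<∣π∣ (suc k))) (∣fromℕ∣≤1 n) ⟩
        ℝ.1# ℝ.* ∣ π ∣ ℝ.^ suc k      ≈⟨ ℝ.*-identityˡ _ ⟩
        ∣ π ∣ ℝ.^ suc k               <⟨ ∣π∣^suc< k ⟩
        ∣ π ∣ ℝ.^ k                   ≤⟨ ℝ.^-antitone (ℝ.<⇒≤ 0<∣π∣) (ℝ.<⇒≤ ∣π∣<1) {k = k} ℕ.z≤n ⟩
        ℝ.1#                          ∎) (ℝ.<-irrefl ℝ.refl)
      -- Here `n` would be 0 in `K`; an infinite order is not below a finite `ℓ`.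
      compute ⊤⁺ _ ()

-- Eigenvalues over an extension field

module _ {a} (em : ExcludedMiddle a) {ℝ : Reals a} {K L : NonArchimedeanField ℝ}
  {ι : NonArchimedeanField.Carrier K → NonArchimedeanField.Carrier L}
  (isometric : IsIsometricEmbedding K L ι) where
  private
    module K where
      open NonArchimedeanField K public
      open Sum (CommutativeRing.semiring commutativeRing) public using (sum)
    module L where
      open NonArchimedeanField L public
      open NonArchimedeanProperties em L public
      open DominantEigenvalue em L public
      open Sum (CommutativeRing.semiring commutativeRing) public using (sum; sum-cong-≋)
    module ℝ = RealArithmetic em ℝ
  open IsIsometricEmbedding isometric using (isFieldHomomorphism)
  open RingMorphisms.IsRingHomomorphism isFieldHomomorphism

  -- The estimate depends on `A` and `w` only through absolute values of `A i j - w j` and the left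
  -- eigenvector equation. An isometric homomorphism preserves both, so `w` over `K` also controls
  -- eigenvectors over `L`.
  ∣otherEigenvalue∣≤-extension : ∀ {n} {A : K.Matrix (suc n)} {μ w ρ z} → ℝ.0# ℝ.≤ ρ →
    (∀ i j → K.∣ A i j K.- w j ∣ ℝ.≤ ρ) → (transpose A K.*ᵛ w) K.≈ᵛ (μ K.·ᵛ w) →
    L.IsEigenvalue (λ i j → ι (A i j)) z → ¬ z L.≈ ι μ → L.∣ z ∣ ℝ.≤ ρ
  ∣otherEigenvalue∣≤-extension {A = A} {μ} {w} 0≤ρ ∣A-w∣≤ρ wA≈μw =
    L.∣otherEigenvalue∣≤ {A = λ i j → ι (A i j)} {w = ι ∘ w} 0≤ρ
      (λ i j → ℝ.≤-respˡ-≈ (ℝ.trans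
        (ℝ.sym (IsIsometricEmbedding.isometric isometric (A i j K.- w j)))
        (L.∣∣-cong (difference-homo isometric (A i j) (w j)))) (∣A-w∣≤ρ i j))
      (λ j → begin
        L.sum (λ i → ι (A i j) L.* ι (w i))    ≈⟨ L.sum-cong-≋ {x = λ i → ι (A i j) L.* ι (w i)} {y = λ i → ι (A i j K.* w i)}
                                                    (λ i → L.sym (*-homo (A i j) (w i))) ⟩
        L.sum (λ i → ι (A i j K.* w i))        ≈⟨ sum-homo isometric (λ i → A i j K.* w i) ⟨
        ι (K.sum (λ i → A i j K.* w i))        ≈⟨ ⟦⟧-cong (wA≈μw j) ⟩
        ι (μ K.* w j)                          ≈⟨ *-homo μ (w j) ⟩
        ι μ L.* ι (w j)                        ∎)
    where open L.K-Reasoning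

theorem6 :
    ∀ {a} (em : ExcludedMiddle a) (ℝ : Reals a) (K : NonArchimedeanField ℝ)
      (ℂ-K : CompletedAlgebraicClosure K) →
    let module ℝ = Reals ℝ
        open Inverse em ℝ.realField using (_/_)
        open NonArchimedeanField K
        open Inverse em baseField using (_⁻¹)
        open CompletedAlgebraicClosure ℂ-K
    in
    IsComplete → IsNontrivial → HasDiscreteValueGroup →
    (π : Carrier) → IsUniformizer π →
    (ord : Carrier → ℤ ⁺) → IsNormalizedValuation em K π ord →
    (n : ℕ) .{{_ : NonZero n}} (ℓ : ℕ) .{{_ : NonZero ℓ}} →
    twice (ord (fromℕ n)) <⁺ [ + ℓ ] →
    (A : Matrix n) → (∀ i j → A i j ∈ D 1# (∣ π ∣ ℝ.^ ℓ)) →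
    ∃ λ λmax →
      (IsSimpleEigenvalue A λmax ×
       (∀ z → ℂ.IsEigenvalue (λ i j → ι (A i j)) z → ¬ (z ℂ.≈ ι λmax) →
        ℂ.∣ z ∣ ℝ.< ∣ λmax ∣) ×
       ∣ λmax ∣ ℝ.≈ ∣ fromℕ n ∣) ×
      λmax ∈ D (fromℕ n) ((∣ π ∣ ℝ.^ ℓ) / ∣ fromℕ n ∣) ×
      (∃ λ x → IsEigenvector A λmax x ×
               (∀ i → x i ∈ D 1# ((∣ π ∣ ℝ.^ ℓ) / ∣ fromℕ n ∣))) ×
      (∃ λ P → (λ k → (λmax ⁻¹ ·ᴹ A) ^ᴹ k) ⟶ᴹ P ×
               IsProjectionOntoEigenspace P A λmax)
theorem6 em ℝ K ℂ-K complete nontrivial discrete π uniformizer ord valuation zero ℓ 2ord<ℓ A A-near =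
  contradiction ≡.refl (ℕ.≢-nonZero⁻¹ 0)
theorem6 em ℝ K ℂ-K complete nontrivial discrete π uniformizer ord valuation (suc m) ℓ 2ord<ℓ A A-near =
  combine (PowerIteration.eigenvector A A-near) (PowerIteration.eigenvector (transpose A) λ i j → A-near j i)
  where
  open NonArchimedeanField K hiding (zero)
  open FieldProperties em baseField using (1≉0)
  open NonArchimedeanProperties em K
  open DominantEigenvalue em K
  open SimpleEigenvalue em K
  open Uniformizer em K
  open CompletedAlgebraicClosure ℂ-K using (module ℂ; ι; K→K̄-isometric; K̄→ℂ-isometric)
  module ℝ = RealArithmetic em ℝ
  open IntegerSolver commutativeRing

  π≉0′ : π ≉ 0#
  π≉0′ = π≉0 uniformizer valuation nontrivial

  open NearAllOnes complete m (ℝ.^-positive (∣∣-positive π≉0′) ℓ)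
    (∣π∣^ℓ<∣n∣² uniformizer valuation nontrivial (suc m) ℓ 2ord<ℓ)

  Eigendata : Matrix (suc m) → Set _
  Eigendata B = ∃ λ μ → ∃ λ x →
    NearOne ρ x × x zero ≈ 1# × (B *ᵛ x) ≈ᵛ (μ ·ᵛ x) × μ ∈ D (fromℕ (suc m)) ρ

  combine : Eigendata A → Eigendata (transpose A) → _
  combine (μ , x , x-near , x₀≈1 , Ax≈μx , μ-near) (μ′ , w , w-near , _ , wA≈μ′w , _) =
    μ ,
    (((x , x-eigenvector) , simple) , others , ∣μ∣≈ν) ,
    μ-near ,
    (x , x-eigenvector , x-near) ,
    (P , converges , isProjection)
    where
    open Projection A-near μ-near x-near Ax≈μx w-near wA≈μ′w

    ∣μ∣≈ν : ∣ μ ∣ ℝ.≈ ∣ fromℕ (suc m) ∣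
    ∣μ∣≈ν = ∣near-n∣ μ-near

    ρ<∣μ∣ : ρ ℝ.< ∣ μ ∣
    ρ<∣μ∣ = ℝ.<-respʳ-≈ (ℝ.sym ∣μ∣≈ν) ρ<ν

    x-eigenvector : IsEigenvector A μ x
    x-eigenvector = (λ x≈0 → 1≉0 (trans (sym x₀≈1) (x≈0 zero))) , Ax≈μx

    others : ∀ z → ℂ.IsEigenvalue (λ i j → ι (A i j)) z → ¬ (z ℂ.≈ ι μ) → ℂ.∣ z ∣ ℝ.< ∣ μ ∣
    others z z-eigenvalue z≉μ = ℝ.≤-<-trans
      (∣otherEigenvalue∣≤-extension em (isometric-∘ K→K̄-isometric K̄→ℂ-isometric)
        (ℝ.<⇒≤ 0<ρ) ∣A-w∣≤ρ (λ j → trans (wA≈μ′w j) (*-congʳ μ′≈μ)) z-eigenvalue z≉μ)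
      ρ<∣μ∣

    C : Matrix m
    C i j = A (suc i) (suc j) - x (suc i) * A zero (suc j)

    -- Writing `a - x b` as `(a - b) - (x - 1) b` exposes two small terms: entries of `A` agree up
    -- to `ε`, and `x` is within `ρ` of 1.
    ∣C∣≤ρ : ∀ i j → ∣ C i j ∣ ℝ.≤ ρ
    ∣C∣≤ρ i j = ℝ.≤-respˡ-≈ (∣∣-cong (split (A (suc i) (suc j)) (x (suc i)) (A zero (suc j))))
      (∣-∣≤ (ℝ.≤-trans (∣nearOne-nearOne∣≤ (A-near (suc i) (suc j)) (A-near zero (suc j))) ε≤ρ)
            (ℝ.≤-respʳ-≈ (ℝ.*-identityʳ ρ)
              (∣*∣≤ (x-near (suc i)) (nearOne⇒∣∣≤1 (ℝ.≤-trans ε≤ρ ρ≤1) (A-near zero (suc j))))))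
      where
      split : ∀ a x b → (a - b) - (x - 1#) * b ≈ a - x * b
      split = solve 3 (λ a x b → (a :- b) :- (x :- con (+ 1)) :* b := a :- x :* b) refl

    -- The test points are `μ + πᵏ`. For `|t - μ| < |μ|` the value `|t|` equals `|μ| > ρ`, so the
    -- cofactor has constant absolute value `|μ|ᵐ` near `μ`; this is the lower bound `δ`.
    simple : Polynomials.HasRootOfMultiplicity rawRing (Polynomials.charPoly rawRing A) μ 1
    simple = simpleRoot π≉0′ (∣π∣<1 uniformizer valuation)
      (ℝ.≤-trans (ℝ.≤-reflexive ∣μ∣≈ν) (∣fromℕ∣≤1 (suc m)))
      0<∣μ∣ (ℝ.^-positive 0<∣μ∣ m)
      (charPoly-deflate A x₀≈1 Ax≈μx)
      (λ t ∣t-μ∣<∣μ∣ → let ∣t∣≈∣μ∣ = isosceles ∣t-μ∣<∣μ∣ in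
        ℝ.≤-reflexive (ℝ.sym (ℝ.trans
          (∣det[t-C]∣ C (ℝ.<-respʳ-≈ (ℝ.sym ∣t∣≈∣μ∣) ρ<∣μ∣) ∣C∣≤ρ) (ℝ.^-congˡ m ∣t∣≈∣μ∣))))
      where
      0<∣μ∣ : ℝ.0# ℝ.< ∣ μ ∣
      0<∣μ∣ = ℝ.<-respʳ-≈ (ℝ.sym ∣μ∣≈ν) 0<ν
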